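{- Let $\mathbf{C}$ be an adhesive category in which all final pullback complements (FPCs) along monomorphisms exist and in which monomorphisms are stable under FPCs. Let $p_1,p_2,p_3\in\mathrm{Lin}(\mathbf{C})$. Then there exists a bijective correspondence between pairs of SqPO-admissible matches $(\mathbf{m}_{21},\mathbf{m}_{3(21)})$, with $\mathbf{m}_{21}\in\mathsf{M}_{p_2}(p_1)$ and $\mathbf{m}_{3(21)}\in\mathsf{M}_{p_3}(p_2{}^{\mathbf{m}_{21}}\!\circ p_1)$, and pairs $(\mathbf{m}_{32},\mathbf{m}_{(32)1})$, with $\mathbf{m}_{32}\in\mathsf{M}_{p_3}(p_2)$ and $\mathbf{m}_{(32)1}\in\mathsf{M}_{p_3{}^{\mathbf{m}_{32}}\circ p_2}(p_1)$, such that for corresponding pairs $$p_3{}^{\mathbf{m}_{3(21)}}\!\circ\left(p_2{}^{\mathbf{m}_{21}}\!\circ p_1\right)\;\cong\;\left(p_3{}^{\mathbf{m}_{32}}\!\circ p_2\right){}^{\mathbf{m}_{(32)1}}\!\circ p_1.$$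
   Context: A category is adhesive if it has pushouts along monomorphisms, has pullbacks, and pushouts along monomorphisms are van Kampen squares. Final pullback complement (FPC): given $a:A\to B$, $c:B\to C$, a pair $(d:D\to C,\ b:A\to D)$ is an FPC of $(c,a)$ if $c\circ a=d\circ b$, this square is a pullback, and for all $x:E\to B$, $y:E\to F$, $z:F\to C$, $w:E\to A$ such that $(E,x,y)$ is a pullback of $(c,z)$ and $a\circ w=x$, there is a unique $w^*:F\to D$ with $d\circ w^*=z$, $w^*\circ y=b\circ w$. "All FPCs along monomorphisms exist" means for every composable pair of monomorphisms $K\xrightarrow{i}I\xrightarrow{m}X$ an FPC of $(m,i)$ exists; "stable under FPCs" means these FPCs consist of monomorphisms. $\mathrm{Lin}(\mathbf{C})$: isomorphism classes of spans of monomorphisms $p=(O\xleftarrow{o}K\xrightarrow{i}I)$ (linear rules). SqPO composition: for $p_j=(O_j\xleftarrow{o_j}K_j\xrightarrow{i_j}I_j)$, $j=1,2$, a span of monomorphisms $\mathbf{m}=(I_2\xleftarrow{m_2}M_{21}\xrightarrow{m_1}O_1)$ (spans differing by an isomorphism of $M_{21}$ compatible with both legs identified) is an SqPO-admissible match of $p_2$ into $p_1$, written $\mathbf{m}\in\mathsf{M}_{p_2}(p_1)$, if, with $I_2\xrightarrow{n_2}N_{21}\xleftarrow{n_1}O_1$ the pushout of $\mathbf{m}$, there is a pushout complement $K_1\xrightarrow{k_1}\overline{K}_1\xrightarrow{o_1'}N_{21}$ of $K_1\xrightarrow{o_1}O_1\xrightarrow{n_1}N_{21}$ (making $(K_1,O_1,N_{21},\overline{K}_1)$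 a pushout). Then take the FPC $(i_2':\overline{K}_2\to N_{21},k_2:K_2\to\overline{K}_2)$ of $(n_2,i_2)$; the pushout $O_{21}$ (with $o_2':\overline{K}_2\to O_{21}$) of $O_2\xleftarrow{o_2}K_2\xrightarrow{k_2}\overline{K}_2$; the pushout $I_{21}$ (with $i_1':\overline{K}_1\to I_{21}$) of $I_1\xleftarrow{i_1}K_1\xrightarrow{k_1}\overline{K}_1$; and the pullback $K_{21}$ (with $i_2'':K_{21}\to\overline{K}_2$, $o_1'':K_{21}\to\overline{K}_1$) of $\overline{K}_2\xrightarrow{i_2'}N_{21}\xleftarrow{o_1'}\overline{K}_1$. The composite is $p_2{}^{\mathbf{m}}\!\circ p_1:=(O_{21}\xleftarrow{o_2'\circ i_2''}K_{21}\xrightarrow{i_1'\circ o_1''}I_{21})\in\mathrm{Lin}(\mathbf{C})$. -}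

module Defs where

open import Level using (Level; suc; _⊔_)
open import Data.Product using (Σ; Σ-syntax; _×_; _,_; proj₁; proj₂; ∃!)
open import Function.Bundles using (_⇔_; Equivalence)
open import Relation.Binary.Bundles using (Setoid)
open import Relation.Binary.Structures using (IsEquivalence)
import Relation.Binary.Reasoning.Setoid as SetoidReasoning

-- Hom-sets are setoids: agda-stdlib has no category theory and Agda has no
-- quotient types.
record Category (o ℓ e : Level) : Set (suc (o ⊔ ℓ ⊔ e)) where
  infix  4 _≈_ _⇒_
  infixr 9 _∘_
  field
    Obj : Set o
    _⇒_ : Obj → Obj → Set ℓ
    _≈_ : ∀ {A B} → A ⇒ B → A ⇒ B → Set e
    id  : ∀ {A} → A ⇒ A
    _∘_ : ∀ {A B C} → B ⇒ C → A ⇒ B → A ⇒ C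

    isEquivalence : ∀ {A B} → IsEquivalence (_≈_ {A} {B})
    assoc     : ∀ {A B C D} {f : A ⇒ B} {g : B ⇒ C} {h : C ⇒ D} →
                (h ∘ g) ∘ f ≈ h ∘ (g ∘ f)
    identityˡ : ∀ {A B} {f : A ⇒ B} → id ∘ f ≈ f
    identityʳ : ∀ {A B} {f : A ⇒ B} → f ∘ id ≈ f
    ∘-resp-≈  : ∀ {A B C} {f h : B ⇒ C} {g i : A ⇒ B} →
                f ≈ h → g ≈ i → f ∘ g ≈ h ∘ i

  homSetoid : Obj → Obj → Setoid ℓ e
  homSetoid A B = record { Carrier = A ⇒ B ; _≈_ = _≈_ ; isEquivalence = isEquivalence }

  module Equiv {A B : Obj} = IsEquivalence (isEquivalence {A} {B})
  module HomReasoning {A B : Obj} = SetoidReasoning (homSetoid A B)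

  ∘-resp-≈ˡ : ∀ {A B C} {f h : B ⇒ C} {g : A ⇒ B} → f ≈ h → f ∘ g ≈ h ∘ g
  ∘-resp-≈ˡ p = ∘-resp-≈ p Equiv.refl

  ∘-resp-≈ʳ : ∀ {A B C} {f : B ⇒ C} {g i : A ⇒ B} → g ≈ i → f ∘ g ≈ f ∘ i
  ∘-resp-≈ʳ p = ∘-resp-≈ Equiv.refl p

module _ {o ℓ e : Level} (C : Category o ℓ e) where
  open Category C

  Mono : ∀ {A B} → A ⇒ B → Set (o ⊔ ℓ ⊔ e)
  Mono {A} f = ∀ {X} (g h : X ⇒ A) → f ∘ g ≈ f ∘ h → g ≈ h

  record Iso (A B : Obj) : Set (ℓ ⊔ e) where
    field
      to   : A ⇒ B
      from : B ⇒ A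
      isoˡ : from ∘ to ≈ id
      isoʳ : to ∘ from ≈ id

  --       p₂
  --    P ───→ Y
  -- p₁ │      │ g
  --    X ───→ Z
  --       f
  record IsPullback {P X Y Z} (p₁ : P ⇒ X) (p₂ : P ⇒ Y)
                    (f : X ⇒ Z) (g : Y ⇒ Z) : Set (o ⊔ ℓ ⊔ e) where
    field
      commute   : f ∘ p₁ ≈ g ∘ p₂
      universal : ∀ {Q} (h₁ : Q ⇒ X) (h₂ : Q ⇒ Y) → f ∘ h₁ ≈ g ∘ h₂ →
                  ∃! _≈_ (λ (u : Q ⇒ P) → p₁ ∘ u ≈ h₁ × p₂ ∘ u ≈ h₂)

  --       g
  --    A ───→ Y
  --  f │      │ q₂
  --    X ───→ Q
  --       q₁
  record IsPushout {A X Y Q} (f : A ⇒ X) (g : A ⇒ Y)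
                   (q₁ : X ⇒ Q) (q₂ : Y ⇒ Q) : Set (o ⊔ ℓ ⊔ e) where
    field
      commute   : q₁ ∘ f ≈ q₂ ∘ g
      universal : ∀ {R} (h₁ : X ⇒ R) (h₂ : Y ⇒ R) → h₁ ∘ f ≈ h₂ ∘ g →
                  ∃! _≈_ (λ (u : Q ⇒ R) → u ∘ q₁ ≈ h₁ × u ∘ q₂ ≈ h₂)

  record Pullback {X Y Z} (f : X ⇒ Z) (g : Y ⇒ Z) : Set (o ⊔ ℓ ⊔ e) where
    field
      {P}        : Obj
      p₁         : P ⇒ X
      p₂         : P ⇒ Y
      isPullback : IsPullback p₁ p₂ f g

  record Pushout {A X Y} (f : A ⇒ X) (g : A ⇒ Y) : Set (o ⊔ ℓ ⊔ e) where
    field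
      {Q}       : Obj
      q₁        : X ⇒ Q
      q₂        : Y ⇒ Q
      isPushout : IsPushout f g q₁ q₂

  -- A complement of the composable pair A ─f→ X ─q₁→ Q.
  record PushoutComplement {A X Q} (f : A ⇒ X) (q₁ : X ⇒ Q) : Set (o ⊔ ℓ ⊔ e) where
    field
      {Y}       : Obj
      g         : A ⇒ Y
      q₂        : Y ⇒ Q
      isPushout : IsPushout f g q₁ q₂

  -- In every commutative cube over the given square (primed arrows on top,
  -- vertical arrows a, x, y, q) whose two back faces are pullbacks, the two
  -- front faces are pullbacks iff the top face is a pushout.
  IsVanKampen : ∀ {A X Y Q} (f : A ⇒ X) (g : A ⇒ Y) (q₁ : X ⇒ Q) (q₂ : Y ⇒ Q) →
                Set (o ⊔ ℓ ⊔ e)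
  IsVanKampen {A} {X} {Y} {Q} f g q₁ q₂ =
    ∀ {A′ X′ Y′ Q′}
      (f′ : A′ ⇒ X′) (g′ : A′ ⇒ Y′) (q₁′ : X′ ⇒ Q′) (q₂′ : Y′ ⇒ Q′)
      (a : A′ ⇒ A) (x : X′ ⇒ X) (y : Y′ ⇒ Y) (q : Q′ ⇒ Q) →
      q₁′ ∘ f′ ≈ q₂′ ∘ g′ →
      x ∘ f′ ≈ f ∘ a → y ∘ g′ ≈ g ∘ a →
      q ∘ q₁′ ≈ q₁ ∘ x → q ∘ q₂′ ≈ q₂ ∘ y →
      IsPullback f′ a x f → IsPullback g′ a y g →
      (IsPullback q₁′ x q q₁ × IsPullback q₂′ y q q₂) ⇔ IsPushout f′ g′ q₁′ q₂′

  -- "Along a monomorphism": one leg of the span is monic.  Pushouts and van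
  -- Kampen squares are symmetric in the two legs, so it may be taken to be f.
  record Adhesive : Set (o ⊔ ℓ ⊔ e) where
    field
      pushout   : ∀ {A X Y} (f : A ⇒ X) (g : A ⇒ Y) → Mono f → Pushout f g
      pullback  : ∀ {X Y Z} (f : X ⇒ Z) (g : Y ⇒ Z) → Pullback f g
      vanKampen : ∀ {A X Y Q} {f : A ⇒ X} {g : A ⇒ Y} {q₁ : X ⇒ Q} {q₂ : Y ⇒ Q} →
                  Mono f → IsPushout f g q₁ q₂ → IsVanKampen f g q₁ q₂

  -- (d , b) is a final pullback complement of (c , a):
  --
  --       b
  --    A ───→ D
  --  a │      │ d
  --    B ───→ C
  --       c
  record IsFPC {A B C D} (c : B ⇒ C) (a : A ⇒ B)
               (d : D ⇒ C) (b : A ⇒ D) : Set (o ⊔ ℓ ⊔ e) where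
    field
      isPullback : IsPullback a b c d
      final      : ∀ {E F} (x : E ⇒ B) (y : E ⇒ F) (z : F ⇒ C) (w : E ⇒ A) →
                   IsPullback x y c z → a ∘ w ≈ x →
                   ∃! _≈_ (λ (w* : F ⇒ D) → d ∘ w* ≈ z × w* ∘ y ≈ b ∘ w)

  record FPC {A B C} (c : B ⇒ C) (a : A ⇒ B) : Set (o ⊔ ℓ ⊔ e) where
    field
      {D}   : Obj
      d     : D ⇒ C
      b     : A ⇒ D
      isFPC : IsFPC c a d b

  HasFPCsAlongMonos : Set (o ⊔ ℓ ⊔ e)
  HasFPCsAlongMonos = ∀ {K I X} (m : I ⇒ X) (i : K ⇒ I) → Mono m → Mono i → FPC m i

  MonosStableUnderFPCs : Set (o ⊔ ℓ ⊔ e)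
  MonosStableUnderFPCs =
    ∀ {K I X D} {m : I ⇒ X} {i : K ⇒ I} {d : D ⇒ X} {b : K ⇒ D} →
    Mono m → Mono i → IsFPC m i d b → Mono d × Mono b

  -- A representative of an element of Lin(C); see `Lin` below.
  record LinearRule : Set (o ⊔ ℓ ⊔ e) where
    field
      {O K I} : Obj
      outₗ    : K ⇒ O
      inₗ     : K ⇒ I
      out-mono : Mono outₗ
      in-mono  : Mono inₗ

  record _≅_ (p q : LinearRule) : Set (ℓ ⊔ e) where
    private
      module p = LinearRule p
      module q = LinearRule q
    field
      isoO : Iso p.O q.O
      isoK : Iso p.K q.K
      isoI : Iso p.I q.I
      out-commute : Iso.to isoO ∘ p.outₗ ≈ q.outₗ ∘ Iso.to isoK
      in-commute  : Iso.to isoI ∘ p.inₗ ≈ q.inₗ ∘ Iso.to isoK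

  open Equiv
  open HomReasoning

  iso-refl : ∀ {A} → Iso A A
  iso-refl = record { to = id ; from = id ; isoˡ = identityˡ ; isoʳ = identityˡ }

  iso-sym : ∀ {A B} → Iso A B → Iso B A
  iso-sym α = record { to = from ; from = to ; isoˡ = isoʳ ; isoʳ = isoˡ }
    where open Iso α

  cancel : ∀ {A B C D} {f : C ⇒ D} {g : B ⇒ C} {h : B ⇒ D} {k : A ⇒ B} →
           f ∘ g ≈ h → f ∘ (g ∘ k) ≈ h ∘ k
  cancel p = trans (sym assoc) (∘-resp-≈ˡ p)

  iso-trans : ∀ {A B C} → Iso A B → Iso B C → Iso A C
  iso-trans α β = record
    { to   = β.to ∘ α.to
    ; from = α.from ∘ β.from
    ; isoˡ = trans assoc (trans (∘-resp-≈ʳ (trans (cancel β.isoˡ) identityˡ)) α.isoˡ)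
    ; isoʳ = trans assoc (trans (∘-resp-≈ʳ (trans (cancel α.isoʳ) identityˡ)) β.isoʳ)
    }
    where
      module α = Iso α
      module β = Iso β

  square-refl : ∀ {A B} {f : A ⇒ B} → id ∘ f ≈ f ∘ id
  square-refl = trans identityˡ (sym identityʳ)

  square-sym : ∀ {A B A′ B′} {f : A ⇒ B} {f′ : A′ ⇒ B′}
               (α : Iso A A′) (β : Iso B B′) →
               Iso.to β ∘ f ≈ f′ ∘ Iso.to α →
               Iso.from β ∘ f′ ≈ f ∘ Iso.from α
  square-sym {f = f} {f′} α β p = begin
    β.from ∘ f′                          ≈⟨ identityʳ ⟨
    (β.from ∘ f′) ∘ id                   ≈⟨ ∘-resp-≈ʳ α.isoʳ ⟨
    (β.from ∘ f′) ∘ (α.to ∘ α.from)      ≈⟨ assoc ⟩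
    β.from ∘ (f′ ∘ (α.to ∘ α.from))      ≈⟨ ∘-resp-≈ʳ (cancel (sym p)) ⟩
    β.from ∘ ((β.to ∘ f) ∘ α.from)       ≈⟨ ∘-resp-≈ʳ assoc ⟩
    β.from ∘ (β.to ∘ (f ∘ α.from))       ≈⟨ cancel β.isoˡ ⟩
    id ∘ (f ∘ α.from)                    ≈⟨ identityˡ ⟩
    f ∘ α.from                           ∎
    where
      module α = Iso α
      module β = Iso β

  square-trans : ∀ {A B A′ B′ A″ B″} {f : A ⇒ B} {f′ : A′ ⇒ B′} {f″ : A″ ⇒ B″}
                 {a : A ⇒ A′} {a′ : A′ ⇒ A″} {b : B ⇒ B′} {b′ : B′ ⇒ B″} →
                 b ∘ f ≈ f′ ∘ a → b′ ∘ f′ ≈ f″ ∘ a′ →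
                 (b′ ∘ b) ∘ f ≈ f″ ∘ (a′ ∘ a)
  square-trans p q =
    trans assoc (trans (∘-resp-≈ʳ p) (trans (cancel q) assoc))

  under-sym : ∀ {A B B′} {f : A ⇒ B} {f′ : A ⇒ B′} (β : Iso B B′) →
              Iso.to β ∘ f ≈ f′ → Iso.from β ∘ f′ ≈ f
  under-sym β p =
    trans (∘-resp-≈ʳ (sym p)) (trans (cancel (Iso.isoˡ β)) identityˡ)

  under-trans : ∀ {A B B′ B″} {f : A ⇒ B} {f′ : A ⇒ B′} {f″ : A ⇒ B″}
                {b : B ⇒ B′} {b′ : B′ ⇒ B″} →
                b ∘ f ≈ f′ → b′ ∘ f′ ≈ f″ → (b′ ∘ b) ∘ f ≈ f″
  under-trans p q = trans assoc (trans (∘-resp-≈ʳ p) q)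

  over-sym : ∀ {A A′ B} {f : A ⇒ B} {f′ : A′ ⇒ B} (α : Iso A A′) →
             f′ ∘ Iso.to α ≈ f → f ∘ Iso.from α ≈ f′
  over-sym α p =
    trans (∘-resp-≈ˡ (sym p)) (trans assoc (trans (∘-resp-≈ʳ (Iso.isoʳ α)) identityʳ))

  over-trans : ∀ {A A′ A″ B} {f : A ⇒ B} {f′ : A′ ⇒ B} {f″ : A″ ⇒ B}
               {a : A ⇒ A′} {a′ : A′ ⇒ A″} →
               f′ ∘ a ≈ f → f″ ∘ a′ ≈ f′ → f″ ∘ (a′ ∘ a) ≈ f
  over-trans p q = trans (cancel q) p

  mono-∘ : ∀ {A B C} {f : B ⇒ C} {g : A ⇒ B} → Mono f → Mono g → Mono (f ∘ g)
  mono-∘ f-mono g-mono h k p =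
    g-mono h k (f-mono _ _ (trans (sym assoc) (trans p assoc)))

  pullback-swap : ∀ {P X Y Z} {p₁ : P ⇒ X} {p₂ : P ⇒ Y} {f : X ⇒ Z} {g : Y ⇒ Z} →
                  IsPullback p₁ p₂ f g → IsPullback p₂ p₁ g f
  pullback-swap pb = record
    { commute   = sym commute
    ; universal = λ h₁ h₂ p →
        let u , (e₁ , e₂) , u! = universal h₂ h₁ (sym p)
        in u , (e₂ , e₁) , λ (e₁′ , e₂′) → u! (e₂′ , e₁′)
    }
    where open IsPullback pb

  pushout-swap : ∀ {A X Y Q} {f : A ⇒ X} {g : A ⇒ Y} {q₁ : X ⇒ Q} {q₂ : Y ⇒ Q} →
                 IsPushout f g q₁ q₂ → IsPushout g f q₂ q₁
  pushout-swap po = record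
    { commute   = sym commute
    ; universal = λ h₁ h₂ p →
        let u , (e₁ , e₂) , u! = universal h₂ h₁ (sym p)
        in u , (e₂ , e₁) , λ (e₁′ , e₂′) → u! (e₂′ , e₁′)
    }
    where open IsPushout po

  mono-pullback : ∀ {P X Y Z} {p₁ : P ⇒ X} {p₂ : P ⇒ Y} {f : X ⇒ Z} {g : Y ⇒ Z} →
                  IsPullback p₁ p₂ f g → Mono f → Mono p₂
  mono-pullback {p₁ = p₁} {p₂} {f} {g} pb f-mono h k p =
    let q = f-mono _ _ (begin
              f ∘ (p₁ ∘ h)  ≈⟨ cancel commute ⟩
              (g ∘ p₂) ∘ h  ≈⟨ assoc ⟩
              g ∘ (p₂ ∘ h)  ≈⟨ ∘-resp-≈ʳ p ⟩
              g ∘ (p₂ ∘ k)  ≈⟨ assoc ⟨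
              (g ∘ p₂) ∘ k  ≈⟨ cancel commute ⟨
              f ∘ (p₁ ∘ k)  ∎)
        _ , _ , u! = universal (p₁ ∘ h) (p₂ ∘ h) (trans (cancel commute) assoc)
    in trans (sym (u! (refl , refl))) (u! (sym q , sym p))
    where open IsPullback pb

  ≅-isEquivalence : IsEquivalence _≅_
  ≅-isEquivalence = record
    { refl  = record
        { isoO = iso-refl ; isoK = iso-refl ; isoI = iso-refl
        ; out-commute = square-refl ; in-commute = square-refl }
    ; sym   = ≅-sym
    ; trans = ≅-trans
    }
    where
      ≅-sym : ∀ {p q} → p ≅ q → q ≅ p
      ≅-sym r = record
        { isoO = iso-sym isoO ; isoK = iso-sym isoK ; isoI = iso-sym isoI
        ; out-commute = square-sym isoK isoO out-commute
        ; in-commute  = square-sym isoK isoI in-commute }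
        where open _≅_ r

      ≅-trans : ∀ {p q r} → p ≅ q → q ≅ r → p ≅ r
      ≅-trans r s = record
        { isoO = iso-trans r.isoO s.isoO
        ; isoK = iso-trans r.isoK s.isoK
        ; isoI = iso-trans r.isoI s.isoI
        ; out-commute = square-trans r.out-commute s.out-commute
        ; in-commute  = square-trans r.in-commute s.in-commute }
        where
          module r = _≅_ r
          module s = _≅_ s

  Lin : Setoid (o ⊔ ℓ ⊔ e) (ℓ ⊔ e)
  Lin = record { Carrier = LinearRule ; _≈_ = _≅_ ; isEquivalence = ≅-isEquivalence }

  module SqPO (adhesive : Adhesive) (hasFPCs : HasFPCsAlongMonos)
              (stable : MonosStableUnderFPCs) where
    open Adhesive adhesive

    -- Apply the van Kampen property to the cube with top face
    -- (id , g , g , id) and vertical arrows id, f, id, q₂: its front face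
    -- exhibits (id , id) as the kernel pair of q₂.
    mono-pushout : ∀ {A X Y Q} {f : A ⇒ X} {g : A ⇒ Y} {q₁ : X ⇒ Q} {q₂ : Y ⇒ Q} →
                   Mono f → IsPushout f g q₁ q₂ → Mono q₂
    mono-pushout {f = f} {g} {q₁} {q₂} f-mono po h k p =
      let _ , (e₁ , e₂) , _ = IsPullback.universal front h k p
      in trans (sym e₁) e₂
      where
        cube = vanKampen f-mono po id g g id id f id q₂
                 (trans identityʳ (sym identityˡ))
                 refl
                 (trans identityˡ (sym identityʳ))
                 (sym (IsPushout.commute po))
                 refl
                 (record
                   { commute   = refl
                   ; universal = λ h₁ h₂ q → h₁ ,
                       (identityˡ , trans identityˡ (f-mono _ _ q)) ,
                       λ (e₁ , _) → trans (sym e₁) identityˡ })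
                 (record
                   { commute   = trans identityˡ (sym identityʳ)
                   ; universal = λ h₁ h₂ q → h₂ ,
                       (trans (sym q) identityˡ , identityˡ) ,
                       λ (_ , e₂) → trans (sym e₂) identityˡ })
        front : IsPullback id id q₂ q₂
        front = proj₂ (Equivalence.from cube (record
                  { commute   = trans identityʳ (sym identityˡ)
                  ; universal = λ h₁ h₂ q → h₂ ,
                      (trans (sym q) identityʳ , identityʳ) ,
                      λ (_ , e₂) → trans (sym e₂) identityʳ }))

    -- A match m ∈ M_{p₂}(p₁), before identifying isomorphic spans (see `_≈ᴹ_`).
    record Match (p₂ p₁ : LinearRule) : Set (o ⊔ ℓ ⊔ e) where
      private
        module p₁ = LinearRule p₁
        module p₂ = LinearRule p₂
      field
        {M}     : Obj
        m₂      : M ⇒ p₂.I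
        m₁      : M ⇒ p₁.O
        m₂-mono : Mono m₂
        m₁-mono : Mono m₁
      N₂₁ : Pushout m₂ m₁
      N₂₁ = pushout m₂ m₁ m₂-mono
      field
        complement : PushoutComplement p₁.outₗ (Pushout.q₂ N₂₁)

    module Composition (p₂ p₁ : LinearRule) (m : Match p₂ p₁) where
      private
        module p₁ = LinearRule p₁
        module p₂ = LinearRule p₂
      open Match m using (M; m₂; m₁; m₂-mono; m₁-mono) public

      open Pushout (Match.N₂₁ m) public
        using () renaming (Q to N; q₁ to n₂; q₂ to n₁; isPushout to N-isPushout)

      open PushoutComplement (Match.complement m) public
        using () renaming (Y to K̄₁; g to k₁; q₂ to o₁′; isPushout to K̄₁-isPushout)

      n₂-mono : Mono n₂
      n₂-mono = mono-pushout m₁-mono (pushout-swap N-isPushout)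

      open FPC (hasFPCs n₂ p₂.inₗ n₂-mono p₂.in-mono) public
        using () renaming (D to K̄₂; d to i₂′; b to k₂; isFPC to K̄₂-isFPC)

      open Pushout (pushout p₂.outₗ k₂ p₂.out-mono) public
        using () renaming (Q to O₂₁; q₁ to o₂₁; q₂ to o₂′; isPushout to O₂₁-isPushout)

      open Pushout (pushout p₁.inₗ k₁ p₁.in-mono) public
        using () renaming (Q to I₂₁; q₁ to i₂₁; q₂ to i₁′; isPushout to I₂₁-isPushout)

      open Pullback (pullback i₂′ o₁′) public
        using () renaming (P to K₂₁; p₁ to i₂″; p₂ to o₁″; isPullback to K₂₁-isPullback)

      composite : LinearRule
      composite = record
        { outₗ     = o₂′ ∘ i₂″
        ; inₗ      = i₁′ ∘ o₁″
        ; out-mono = mono-∘ (mono-pushout p₂.out-mono O₂₁-isPushout)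
                            (mono-pullback (pullback-swap K₂₁-isPullback)
                                           (mono-pushout p₁.out-mono K̄₁-isPushout))
        ; in-mono  = mono-∘ (mono-pushout p₁.in-mono I₂₁-isPushout)
                            (mono-pullback K₂₁-isPullback
                              (proj₁ (stable n₂-mono p₂.in-mono K̄₂-isFPC)))
        }

    compose : (p₂ p₁ : LinearRule) → Match p₂ p₁ → LinearRule
    compose = Composition.composite

    -- Isomorphism of matches lying over given arrows β : I₂ ⇒ I₂′ and
    -- α : O₁ ⇒ O₁′.  The pushout complement is not compared: admissibility is
    -- a property of the span.
    record MatchIso {p₂ p₁ p₂′ p₁′ : LinearRule}
                    (β : LinearRule.I p₂ ⇒ LinearRule.I p₂′)
                    (α : LinearRule.O p₁ ⇒ LinearRule.O p₁′)
                    (m : Match p₂ p₁) (m′ : Match p₂′ p₁′) : Set (ℓ ⊔ e) where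
      private
        module m = Match m
        module m′ = Match m′
      field
        isoM       : Iso m.M m′.M
        m₂-commute : β ∘ m.m₂ ≈ m′.m₂ ∘ Iso.to isoM
        m₁-commute : α ∘ m.m₁ ≈ m′.m₁ ∘ Iso.to isoM

    -- The equality of M_{p₂}(p₁).
    _≈ᴹ_ : ∀ {p₂ p₁} → Match p₂ p₁ → Match p₂ p₁ → Set (ℓ ⊔ e)
    _≈ᴹ_ = MatchIso id id

    -- Isomorphism of composition diagrams, identical on p₂ and p₁.  By the
    -- universal properties and monicity of m₁, m₂, there is exactly one such
    -- isomorphism if m ≈ᴹ m′.  It identifies compose p₂ p₁ m canonically with
    -- compose p₂ p₁ m′.
    record CompositionIso {p₂ p₁ : LinearRule} (m m′ : Match p₂ p₁) : Set (ℓ ⊔ e) where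
      private
        module D  = Composition p₂ p₁ m
        module D′ = Composition p₂ p₁ m′
      field
        isoM : Iso D.M D′.M
        isoN : Iso D.N D′.N
        isoK̄₂ : Iso D.K̄₂ D′.K̄₂
        isoK̄₁ : Iso D.K̄₁ D′.K̄₁
        isoO : Iso D.O₂₁ D′.O₂₁
        isoK : Iso D.K₂₁ D′.K₂₁
        isoI : Iso D.I₂₁ D′.I₂₁

        m₂-commute  : D′.m₂ ∘ Iso.to isoM ≈ D.m₂
        m₁-commute  : D′.m₁ ∘ Iso.to isoM ≈ D.m₁
        n₂-commute  : Iso.to isoN ∘ D.n₂ ≈ D′.n₂
        n₁-commute  : Iso.to isoN ∘ D.n₁ ≈ D′.n₁
        k₂-commute  : Iso.to isoK̄₂ ∘ D.k₂ ≈ D′.k₂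
        k₁-commute  : Iso.to isoK̄₁ ∘ D.k₁ ≈ D′.k₁
        i₂′-commute : Iso.to isoN ∘ D.i₂′ ≈ D′.i₂′ ∘ Iso.to isoK̄₂
        o₁′-commute : Iso.to isoN ∘ D.o₁′ ≈ D′.o₁′ ∘ Iso.to isoK̄₁
        o₂₁-commute : Iso.to isoO ∘ D.o₂₁ ≈ D′.o₂₁
        o₂′-commute : Iso.to isoO ∘ D.o₂′ ≈ D′.o₂′ ∘ Iso.to isoK̄₂
        i₂₁-commute : Iso.to isoI ∘ D.i₂₁ ≈ D′.i₂₁
        i₁′-commute : Iso.to isoI ∘ D.i₁′ ≈ D′.i₁′ ∘ Iso.to isoK̄₁
        i₂″-commute : Iso.to isoK̄₂ ∘ D.i₂″ ≈ D′.i₂″ ∘ Iso.to isoK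
        o₁″-commute : Iso.to isoK̄₁ ∘ D.o₁″ ≈ D′.o₁″ ∘ Iso.to isoK

    matchIso-refl : ∀ {p₂ p₁} {m : Match p₂ p₁} → MatchIso id id m m
    matchIso-refl = record
      { isoM = iso-refl ; m₂-commute = square-refl ; m₁-commute = square-refl }

    matchIso-sym : ∀ {p₂ p₁ p₂′ p₁′} {m : Match p₂ p₁} {m′ : Match p₂′ p₁′}
                   (β : Iso (LinearRule.I p₂) (LinearRule.I p₂′))
                   (α : Iso (LinearRule.O p₁) (LinearRule.O p₁′)) →
                   MatchIso (Iso.to β) (Iso.to α) m m′ →
                   MatchIso (Iso.from β) (Iso.from α) m′ m
    matchIso-sym β α r = record
      { isoM = iso-sym isoM
      ; m₂-commute = square-sym isoM β m₂-commute
      ; m₁-commute = square-sym isoM α m₁-commute }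
      where open MatchIso r

    matchIso-trans : ∀ {p₂ p₁ p₂′ p₁′ p₂″ p₁″}
                     {m : Match p₂ p₁} {m′ : Match p₂′ p₁′} {m″ : Match p₂″ p₁″}
                     {β β′ β″ α α′ α″} →
                     β′ ∘ β ≈ β″ → α′ ∘ α ≈ α″ →
                     MatchIso β α m m′ → MatchIso β′ α′ m′ m″ → MatchIso β″ α″ m m″
    matchIso-trans p q r s = record
      { isoM = iso-trans r.isoM s.isoM
      ; m₂-commute = trans (∘-resp-≈ˡ (sym p)) (square-trans r.m₂-commute s.m₂-commute)
      ; m₁-commute = trans (∘-resp-≈ˡ (sym q)) (square-trans r.m₁-commute s.m₁-commute) }
      where
        module r = MatchIso r
        module s = MatchIso s

    ≈ᴹ-isEquivalence : ∀ {p₂ p₁} → IsEquivalence (_≈ᴹ_ {p₂} {p₁})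
    ≈ᴹ-isEquivalence = record
      { refl  = matchIso-refl
      ; sym   = matchIso-sym iso-refl iso-refl
      ; trans = matchIso-trans identityˡ identityˡ }

    compositionIso-isEquivalence : ∀ {p₂ p₁} → IsEquivalence (CompositionIso {p₂} {p₁})
    compositionIso-isEquivalence = record
      { refl  = record
          { isoM = iso-refl ; isoN = iso-refl ; isoK̄₂ = iso-refl ; isoK̄₁ = iso-refl
          ; isoO = iso-refl ; isoK = iso-refl ; isoI = iso-refl
          ; m₂-commute  = identityʳ
          ; m₁-commute  = identityʳ
          ; n₂-commute  = identityˡ
          ; n₁-commute  = identityˡ
          ; k₂-commute  = identityˡ
          ; k₁-commute  = identityˡ
          ; i₂′-commute = square-refl
          ; o₁′-commute = square-refl
          ; o₂₁-commute = identityˡ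
          ; o₂′-commute = square-refl
          ; i₂₁-commute = identityˡ
          ; i₁′-commute = square-refl
          ; i₂″-commute = square-refl
          ; o₁″-commute = square-refl }
      ; sym   = ci-sym
      ; trans = ci-trans
      }
      where
        ci-sym : ∀ {p₂ p₁} {m m′ : Match p₂ p₁} → CompositionIso m m′ → CompositionIso m′ m
        ci-sym r = record
          { isoM = iso-sym isoM ; isoN = iso-sym isoN
          ; isoK̄₂ = iso-sym isoK̄₂ ; isoK̄₁ = iso-sym isoK̄₁
          ; isoO = iso-sym isoO ; isoK = iso-sym isoK ; isoI = iso-sym isoI
          ; m₂-commute  = over-sym isoM m₂-commute
          ; m₁-commute  = over-sym isoM m₁-commute
          ; n₂-commute  = under-sym isoN n₂-commute
          ; n₁-commute  = under-sym isoN n₁-commute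
          ; k₂-commute  = under-sym isoK̄₂ k₂-commute
          ; k₁-commute  = under-sym isoK̄₁ k₁-commute
          ; i₂′-commute = square-sym isoK̄₂ isoN i₂′-commute
          ; o₁′-commute = square-sym isoK̄₁ isoN o₁′-commute
          ; o₂₁-commute = under-sym isoO o₂₁-commute
          ; o₂′-commute = square-sym isoK̄₂ isoO o₂′-commute
          ; i₂₁-commute = under-sym isoI i₂₁-commute
          ; i₁′-commute = square-sym isoK̄₁ isoI i₁′-commute
          ; i₂″-commute = square-sym isoK isoK̄₂ i₂″-commute
          ; o₁″-commute = square-sym isoK isoK̄₁ o₁″-commute }
          where open CompositionIso r

        ci-trans : ∀ {p₂ p₁} {m m′ m″ : Match p₂ p₁} →
                   CompositionIso m m′ → CompositionIso m′ m″ → CompositionIso m m″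
        ci-trans r s = record
          { isoM = iso-trans r.isoM s.isoM ; isoN = iso-trans r.isoN s.isoN
          ; isoK̄₂ = iso-trans r.isoK̄₂ s.isoK̄₂ ; isoK̄₁ = iso-trans r.isoK̄₁ s.isoK̄₁
          ; isoO = iso-trans r.isoO s.isoO
          ; isoK = iso-trans r.isoK s.isoK
          ; isoI = iso-trans r.isoI s.isoI
          ; m₂-commute  = over-trans r.m₂-commute s.m₂-commute
          ; m₁-commute  = over-trans r.m₁-commute s.m₁-commute
          ; n₂-commute  = under-trans r.n₂-commute s.n₂-commute
          ; n₁-commute  = under-trans r.n₁-commute s.n₁-commute
          ; k₂-commute  = under-trans r.k₂-commute s.k₂-commute
          ; k₁-commute  = under-trans r.k₁-commute s.k₁-commute
          ; i₂′-commute = square-trans r.i₂′-commute s.i₂′-commute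
          ; o₁′-commute = square-trans r.o₁′-commute s.o₁′-commute
          ; o₂₁-commute = under-trans r.o₂₁-commute s.o₂₁-commute
          ; o₂′-commute = square-trans r.o₂′-commute s.o₂′-commute
          ; i₂₁-commute = under-trans r.i₂₁-commute s.i₂₁-commute
          ; i₁′-commute = square-trans r.i₁′-commute s.i₁′-commute
          ; i₂″-commute = square-trans r.i₂″-commute s.i₂″-commute
          ; o₁″-commute = square-trans r.o₁″-commute s.o₁″-commute }
          where
            module r = CompositionIso r
            module s = CompositionIso s

    -- Pairs (m₂₁ , m₃₍₂₁₎).  Isomorphic m₂₁, m₂₁′ denote the same match, so
    -- m₃₍₂₁₎ and m₃₍₂₁₎′ are compared along the canonical isomorphism between
    -- the output objects of the two composites.
    MatchPairs₃₍₂₁₎ : (p₃ p₂ p₁ : LinearRule) → Setoid (o ⊔ ℓ ⊔ e) (ℓ ⊔ e)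
    MatchPairs₃₍₂₁₎ p₃ p₂ p₁ = record
      { Carrier = Σ[ m₂₁ ∈ Match p₂ p₁ ] Match p₃ (compose p₂ p₁ m₂₁)
      ; _≈_     = λ (m , n) (m′ , n′) →
                    Σ[ θ ∈ CompositionIso m m′ ]
                      MatchIso id (Iso.to (CompositionIso.isoO θ)) n n′
      ; isEquivalence = record
          { refl  = CI.refl , matchIso-refl
          ; sym   = λ (θ , r) →
                      CI.sym θ , matchIso-sym iso-refl (CompositionIso.isoO θ) r
          ; trans = λ (θ , r) (η , s) →
                      CI.trans θ η , matchIso-trans identityˡ refl r s }
      }
      where module CI = IsEquivalence (compositionIso-isEquivalence {p₂} {p₁})

    -- Pairs (m₃₂ , m₍₃₂₎₁), compared along the canonical isomorphism between
    -- the input objects of the composites.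
    MatchPairs₍₃₂₎₁ : (p₃ p₂ p₁ : LinearRule) → Setoid (o ⊔ ℓ ⊔ e) (ℓ ⊔ e)
    MatchPairs₍₃₂₎₁ p₃ p₂ p₁ = record
      { Carrier = Σ[ m₃₂ ∈ Match p₃ p₂ ] Match (compose p₃ p₂ m₃₂) p₁
      ; _≈_     = λ (m , n) (m′ , n′) →
                    Σ[ θ ∈ CompositionIso m m′ ]
                      MatchIso (Iso.to (CompositionIso.isoI θ)) id n n′
      ; isEquivalence = record
          { refl  = CI.refl , matchIso-refl
          ; sym   = λ (θ , r) →
                      CI.sym θ , matchIso-sym (CompositionIso.isoI θ) iso-refl r
          ; trans = λ (θ , r) (η , s) →
                      CI.trans θ η , matchIso-trans refl identityˡ r s }
      }
      where module CI = IsEquivalence (compositionIso-isEquivalence {p₃} {p₂})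

    composite₃₍₂₁₎ : (p₃ p₂ p₁ : LinearRule) →
                     Setoid.Carrier (MatchPairs₃₍₂₁₎ p₃ p₂ p₁) → LinearRule
    composite₃₍₂₁₎ p₃ p₂ p₁ (m₂₁ , m₃₍₂₁₎) =
      compose p₃ (compose p₂ p₁ m₂₁) m₃₍₂₁₎

    composite₍₃₂₎₁ : (p₃ p₂ p₁ : LinearRule) →
                     Setoid.Carrier (MatchPairs₍₃₂₎₁ p₃ p₂ p₁) → LinearRule
    composite₍₃₂₎₁ p₃ p₂ p₁ (m₃₂ , m₍₃₂₎₁) =
      compose (compose p₃ p₂ m₃₂) p₁ m₍₃₂₎₁

module Submission where

open import Level using (Level; _⊔_)
open import Data.Product using (Σ-syntax; _×_; _,_; proj₁; proj₂)
open import Function.Bundles using (Bijection; Equivalence)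
open import Relation.Binary.Bundles using (Setoid)
open import Defs

-- Either pair of matches determines the same middle diagram.  It consists of an
-- object T in which I₂ is glued to O₁, an object S in which O₂ is glued to I₃,
-- and an object Q, the FPC of K₂ → I₂ → T, such that S is the pushout of O₂ and
-- Q over K₂.  The first matches are recovered as I₂ ∩ O₁ in T and I₃ ∩ O₂ in S,
-- with N₂₁ and N₃₂ the corresponding unions.  The main point is that S is the
-- union of I₃ and O₂₁ iff T is the union of I₃₂ and O₁: since T is N₂₁ ∪ Q and
-- S is N₃₂ ∪ Q, both say that Q is the union of Q ∩ N₂₁ and Q ∩ N₃₂.  The
-- composites agree because each can be read off the middle diagram: with K̄₃ the
-- FPC of K₃ → I₃ → S and R the complement of K₁ → O₁ → T, the composite is
-- O₃ ∪ K̄₃ ← K̄₃ ∩ Q ∩ R → I₁ ∪ R.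

-- Factorizations, pullbacks and pushouts

-- As they stand, the two sides are not symmetric: a match demands a pushout complement on the
-- output side of the first rule, while on the input side of the second rule there is only an FPC. A
-- pushout along a monomorphism is itself an FPC (`pushout-fpc`), so a `Frame` asks for FPCs on both
-- sides, and the passages from left to right and back are one argument, `opposite-fits`, applied to
-- `p₂` and to `flip p₂`. The stronger pushout conditions are added again in `Middle`. No diagram is
-- followed around a round trip. A pair of matches fits a frame that is unique up to isomorphism,
-- and a frame determines the pairs that fit it, so equality of pairs on either side becomes
-- isomorphism of frames, and bijectivity is formal. Adhesivity enters mostly as a principle of case
-- distinction: a generalized element of a pushout along a monomorphism is covered by a part in each
-- leg (`cover-≈`, `cover-⊑`). Many diagram chases thereby become inclusions between subobjects.

module CategoryLemmas {o ℓ e : Level} (C : Category o ℓ e) where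
  open Category C
  open Equiv
  open HomReasoning

  infix 4 _⊑_

  -- For monic `d` this is membership of the generalized element `z` in the subobject `d`. The
  -- factor is then unique, so a bare witness suffices.
  _⊑_ : ∀ {F X T} → F ⇒ T → X ⇒ T → Set (ℓ ⊔ e)
  _⊑_ {F} {X} z d = Σ[ u ∈ F ⇒ X ] d ∘ u ≈ z

  ⊑-intro : ∀ {F X T} {d : X ⇒ T} {u : F ⇒ X} → d ∘ u ⊑ d
  ⊑-intro = _ , refl

  ⊑-trans : ∀ {F X Y T} {z : F ⇒ T} {d : X ⇒ T} {d′ : Y ⇒ T} → z ⊑ d → d ⊑ d′ → z ⊑ d′
  ⊑-trans (u , p) (v , q) = v ∘ u , trans (cancel C q) p

  ⊑-pre : ∀ {G F X T} {z : F ⇒ T} {d : X ⇒ T} {g : G ⇒ F} → z ⊑ d → z ∘ g ⊑ d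
  ⊑-pre (u , p) = u ∘ _ , cancel C p

  ⊑-respˡ : ∀ {F X T} {z z′ : F ⇒ T} {d : X ⇒ T} → z ≈ z′ → z ⊑ d → z′ ⊑ d
  ⊑-respˡ p (u , q) = u , trans q p

  extend : ∀ {A B B′ D E} {f : B ⇒ D} {g : A ⇒ B} {f′ : B′ ⇒ D} {g′ : A ⇒ B′} {h : E ⇒ A} →
           f ∘ g ≈ f′ ∘ g′ → f ∘ (g ∘ h) ≈ f′ ∘ (g′ ∘ h)
  extend p = trans (cancel C p) assoc

  mono-id : ∀ {A} → Mono C (id {A})
  mono-id h k p = trans (sym identityˡ) (trans p identityˡ)

  mono-first : ∀ {A B D} {f : B ⇒ D} {g : A ⇒ B} → Mono C (f ∘ g) → Mono C g
  mono-first fg-mono h k p = fg-mono h k (trans assoc (trans (∘-resp-≈ʳ p) (sym assoc)))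

  mono-resp : ∀ {A B} {f g : A ⇒ B} → f ≈ g → Mono C f → Mono C g
  mono-resp p f-mono h k q =
    f-mono h k (trans (∘-resp-≈ˡ p) (trans q (∘-resp-≈ˡ (sym p))))

  iso-mono : ∀ {A B} (φ : Iso C A B) → Mono C (Iso.to φ)
  iso-mono φ = mono-first (mono-resp (sym (Iso.isoˡ φ)) mono-id)

  -- The form in which a subobject is recognized as the whole object: arguments about unions end in
  -- `id ⊑ f`.
  retract-iso : ∀ {A B} (f : A ⇒ B) → Mono C f → id ⊑ f → Iso C A B
  retract-iso f f-mono (g , p) = record
    { to = f ; from = g ; isoʳ = p
    ; isoˡ = f-mono _ _ (trans (cancel C p) (trans identityˡ (sym identityʳ))) }

  -- Pullbacks

  module _ {P X Y Z} {p₁ : P ⇒ X} {p₂ : P ⇒ Y} {f : X ⇒ Z} {g : Y ⇒ Z} where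

    pullback-intro : Mono C p₁ → Mono C g → f ∘ p₁ ≈ g ∘ p₂ →
      (∀ {F} (h₁ : F ⇒ X) (h₂ : F ⇒ Y) → f ∘ h₁ ≈ g ∘ h₂ → h₁ ⊑ p₁) →
      IsPullback C p₁ p₂ f g
    pullback-intro p₁-mono g-mono comm lift = record
      { commute   = comm
      ; universal = λ h₁ h₂ p → let u , q = lift h₁ h₂ p in
          u , (q , g-mono _ _ (trans (cancel C (sym comm)) (trans assoc (trans (∘-resp-≈ʳ q) p)))) ,
          λ (r , _) → p₁-mono _ _ (trans q (sym r)) }

    pullback-lift : IsPullback C p₁ p₂ f g → ∀ {F} {h₁ : F ⇒ X} {h₂ : F ⇒ Y} →
      f ∘ h₁ ≈ g ∘ h₂ → Σ[ u ∈ F ⇒ P ] (p₁ ∘ u ≈ h₁ × p₂ ∘ u ≈ h₂)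
    pullback-lift pb p = let u , q , _ = IsPullback.universal pb _ _ p in u , q

    pullback-⊑₁ : IsPullback C p₁ p₂ f g → ∀ {F} {h₁ : F ⇒ X} {h₂ : F ⇒ Y} →
      f ∘ h₁ ≈ g ∘ h₂ → h₁ ⊑ p₁
    pullback-⊑₁ pb p = let u , q , _ = pullback-lift pb p in u , q

    pullback-⊑₂ : IsPullback C p₁ p₂ f g → ∀ {F} {h₁ : F ⇒ X} {h₂ : F ⇒ Y} →
      f ∘ h₁ ≈ g ∘ h₂ → h₂ ⊑ p₂
    pullback-⊑₂ pb p = let u , _ , q = pullback-lift pb p in u , q

    pullback-unique : IsPullback C p₁ p₂ f g → ∀ {F} {h k : F ⇒ P} →
      p₁ ∘ h ≈ p₁ ∘ k → p₂ ∘ h ≈ p₂ ∘ k → h ≈ k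
    pullback-unique pb p q =
      let _ , _ , u! = IsPullback.universal pb _ _ (extend (IsPullback.commute pb))
      in trans (sym (u! (p , q))) (u! (refl , refl))

    mono-pullbackʳ : IsPullback C p₁ p₂ f g → Mono C g → Mono C p₁
    mono-pullbackʳ pb = mono-pullback C (pullback-swap C pb)

  --  P′ ─h→ P ─p₂→ Y
  --  │      p₁     │g
  --  X′ ─k→ X ─f→  Z
  module _ {P′ P X′ X Y Z} {p₁ : P ⇒ X} {p₂ : P ⇒ Y} {f : X ⇒ Z} {g : Y ⇒ Z}
           {p₁′ : P′ ⇒ X′} {h : P′ ⇒ P} {k : X′ ⇒ X} (right : IsPullback C p₁ p₂ f g) where

    pullback-paste : IsPullback C p₁′ h k p₁ → IsPullback C p₁′ (p₂ ∘ h) (f ∘ k) g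
    pullback-paste left = record
      { commute   = trans assoc (trans (∘-resp-≈ʳ (IsPullback.commute left)) (extend (IsPullback.commute right)))
      ; universal = λ h₁ h₂ p →
          let v , v₁ , v₂ = pullback-lift right (trans (sym assoc) p)
              u , u₁ , u₂ = pullback-lift left (sym v₁)
          in u , (u₁ , trans assoc (trans (∘-resp-≈ʳ u₂) v₂)) ,
             λ (r , s) → pullback-unique left (trans u₁ (sym r))
               (trans u₂ (pullback-unique right
                 (trans v₁ (trans (∘-resp-≈ʳ (sym r)) (extend (IsPullback.commute left))))
                 (trans v₂ (trans (sym s) assoc)))) }

    pullback-cancel : k ∘ p₁′ ≈ p₁ ∘ h → IsPullback C p₁′ (p₂ ∘ h) (f ∘ k) g →
                      IsPullback C p₁′ h k p₁
    pullback-cancel comm outer = record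
      { commute   = comm
      ; universal = λ h₁ h₂ p →
          let u , u₁ , u₂ = pullback-lift outer {h₁ = h₁} {h₂ = p₂ ∘ h₂}
                              (trans assoc (trans (∘-resp-≈ʳ p) (extend (IsPullback.commute right))))
          in u , (u₁ , pullback-unique right
                         (trans (extend (sym comm)) (trans (∘-resp-≈ʳ u₁) p))
                         (trans (sym assoc) u₂)) ,
             λ (r , s) → pullback-unique outer (trans u₁ (sym r))
                           (trans u₂ (trans (∘-resp-≈ʳ (sym s)) (sym assoc))) }

  pullback-resp : ∀ {P X Y Z} {p₁ p₁′ : P ⇒ X} {p₂ p₂′ : P ⇒ Y} {f f′ : X ⇒ Z} {g g′ : Y ⇒ Z} →
    p₁ ≈ p₁′ → p₂ ≈ p₂′ → f ≈ f′ → g ≈ g′ → IsPullback C p₁ p₂ f g → IsPullback C p₁′ p₂′ f′ g′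
  pullback-resp a b c d pb = record
    { commute   = trans (∘-resp-≈ (sym c) (sym a)) (trans (IsPullback.commute pb) (∘-resp-≈ d b))
    ; universal = λ h₁ h₂ p →
        let u , (r , s) , u! = IsPullback.universal pb h₁ h₂ (trans (∘-resp-≈ˡ c) (trans p (∘-resp-≈ˡ (sym d))))
        in u , (trans (∘-resp-≈ˡ (sym a)) r , trans (∘-resp-≈ˡ (sym b)) s) ,
           λ (r′ , s′) → u! (trans (∘-resp-≈ˡ a) r′ , trans (∘-resp-≈ˡ b) s′) }

  pullback-postmono : ∀ {P X Y Z Z′} {p : P ⇒ X} {q : P ⇒ Y} {f : X ⇒ Z} {g : Y ⇒ Z} {m : Z ⇒ Z′} →
    Mono C m → IsPullback C p q f g → IsPullback C p q (m ∘ f) (m ∘ g)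
  pullback-postmono m-mono pb = record
    { commute   = trans assoc (trans (∘-resp-≈ʳ (IsPullback.commute pb)) (sym assoc))
    ; universal = λ h₁ h₂ r → IsPullback.universal pb h₁ h₂ (m-mono _ _ (trans (sym assoc) (trans r assoc))) }

  pullback-idˡ : ∀ {A B} {f : A ⇒ B} → IsPullback C f id id f
  pullback-idˡ = record
    { commute   = trans identityˡ (sym identityʳ)
    ; universal = λ h₁ h₂ p → h₂ , (trans (sym p) identityˡ , identityˡ) ,
        λ (_ , s) → trans (sym s) identityˡ }

  pullback-mono : ∀ {A B D} {f : A ⇒ B} {m : B ⇒ D} → Mono C m → IsPullback C f id m (m ∘ f)
  pullback-mono m-mono = record
    { commute   = sym identityʳ
    ; universal = λ h₁ h₂ p → h₂ , (m-mono _ _ (trans (sym assoc) (sym p)) , identityˡ) ,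
        λ (_ , s) → trans (sym s) identityˡ }

  -- Pushouts

  module _ {A X Y Q} {f : A ⇒ X} {g : A ⇒ Y} {q₁ : X ⇒ Q} {q₂ : Y ⇒ Q} where

    pushout-desc : IsPushout C f g q₁ q₂ → ∀ {R} {h₁ : X ⇒ R} {h₂ : Y ⇒ R} →
      h₁ ∘ f ≈ h₂ ∘ g → Σ[ u ∈ Q ⇒ R ] (u ∘ q₁ ≈ h₁ × u ∘ q₂ ≈ h₂)
    pushout-desc po p = let u , q , _ = IsPushout.universal po _ _ p in u , q

    pushout-unique : IsPushout C f g q₁ q₂ → ∀ {R} {h k : Q ⇒ R} →
      h ∘ q₁ ≈ k ∘ q₁ → h ∘ q₂ ≈ k ∘ q₂ → h ≈ k
    pushout-unique po p q =
      let _ , _ , u! = IsPushout.universal po _ _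
                         (trans assoc (trans (∘-resp-≈ʳ (IsPushout.commute po)) (sym assoc)))
      in trans (sym (u! (p , q))) (u! (refl , refl))

    -- The two factors need not be assumed compatible on `A`: monicity of `d` forces it.
    pushout-⊑ : IsPushout C f g q₁ q₂ → ∀ {R T} {c : Q ⇒ T} {d : R ⇒ T} → Mono C d →
      c ∘ q₁ ⊑ d → c ∘ q₂ ⊑ d → c ⊑ d
    pushout-⊑ po {c = c} {d} d-mono (u , p) (v , q) =
      let w , w₁ , w₂ = pushout-desc po {h₁ = u} {h₂ = v} (d-mono _ _ (begin
                          d ∘ (u ∘ f)   ≈⟨ cancel C p ⟩
                          (c ∘ q₁) ∘ f  ≈⟨ assoc ⟩
                          c ∘ (q₁ ∘ f)  ≈⟨ ∘-resp-≈ʳ (IsPushout.commute po) ⟩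
                          c ∘ (q₂ ∘ g)  ≈⟨ assoc ⟨
                          (c ∘ q₂) ∘ g  ≈⟨ cancel C q ⟨
                          d ∘ (v ∘ g)   ∎))
      in w , pushout-unique po (trans assoc (trans (∘-resp-≈ʳ w₁) p))
                               (trans assoc (trans (∘-resp-≈ʳ w₂) q))

    pushout-id⊑ : IsPushout C f g q₁ q₂ → ∀ {R} {d : R ⇒ Q} → Mono C d →
      q₁ ⊑ d → q₂ ⊑ d → id ⊑ d
    pushout-id⊑ po d-mono p q =
      pushout-⊑ po d-mono (⊑-respˡ (sym identityˡ) p) (⊑-respˡ (sym identityˡ) q)

    pushout-iso : IsPushout C f g q₁ q₂ → ∀ {R} {r₁ : X ⇒ R} {r₂ : Y ⇒ R} (φ : Iso C Q R) →
      Iso.to φ ∘ q₁ ≈ r₁ → Iso.to φ ∘ q₂ ≈ r₂ → IsPushout C f g r₁ r₂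
    pushout-iso po {R} {r₁} {r₂} φ p q = record
      { commute   = trans (∘-resp-≈ˡ (sym p)) (trans assoc
                      (trans (∘-resp-≈ʳ (IsPushout.commute po)) (cancel C q)))
      ; universal = λ h₁ h₂ r → let u , u₁ , u₂ = pushout-desc po r in
          u ∘ from , (trans assoc (trans (∘-resp-≈ʳ (under-sym C φ p)) u₁) ,
                      trans assoc (trans (∘-resp-≈ʳ (under-sym C φ q)) u₂)) ,
          λ {v} (s , t) → trans (∘-resp-≈ˡ (pushout-unique po {h = u} {k = v ∘ to}
            (trans u₁ (sym (trans assoc (trans (∘-resp-≈ʳ p) s))))
            (trans u₂ (sym (trans assoc (trans (∘-resp-≈ʳ q) t))))))
            (trans assoc (trans (∘-resp-≈ʳ isoʳ) identityʳ)) }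
      where open Iso φ

  pushout-resp : ∀ {A X Y Q} {f f′ : A ⇒ X} {g g′ : A ⇒ Y} {q₁ q₁′ : X ⇒ Q} {q₂ q₂′ : Y ⇒ Q} →
    f ≈ f′ → g ≈ g′ → q₁ ≈ q₁′ → q₂ ≈ q₂′ → IsPushout C f g q₁ q₂ → IsPushout C f′ g′ q₁′ q₂′
  pushout-resp a b c d po = record
    { commute   = trans (∘-resp-≈ (sym c) (sym a)) (trans (IsPushout.commute po) (∘-resp-≈ d b))
    ; universal = λ h₁ h₂ p →
        let u , (r , s) , u! = IsPushout.universal po h₁ h₂ (trans (∘-resp-≈ʳ a) (trans p (∘-resp-≈ʳ (sym b))))
        in u , (trans (∘-resp-≈ʳ (sym c)) r , trans (∘-resp-≈ʳ (sym d)) s) ,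
           λ (r′ , s′) → u! (trans (∘-resp-≈ʳ c) r′ , trans (∘-resp-≈ʳ d) s′) }

  --  A ─g→ Y ─h→ Y′
  --  │f    q₂    │r
  --  X ─q₁→ Q ─k→ Q′
  module _ {A X Y Q Y′ Q′} {f : A ⇒ X} {g : A ⇒ Y} {q₁ : X ⇒ Q} {q₂ : Y ⇒ Q}
           {h : Y ⇒ Y′} {k : Q ⇒ Q′} {r : Y′ ⇒ Q′} (left : IsPushout C f g q₁ q₂) where

    pushout-paste : IsPushout C q₂ h k r → IsPushout C f (h ∘ g) (k ∘ q₁) r
    pushout-paste right = record
      { commute   = trans assoc (trans (∘-resp-≈ʳ (IsPushout.commute left)) (extend (IsPushout.commute right)))
      ; universal = λ h₁ h₂ p →
          let v , v₁ , v₂ = pushout-desc left (trans p (sym assoc))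
              u , u₁ , u₂ = pushout-desc right v₂
          in u , (trans (cancel C u₁) v₁ , u₂) ,
             λ (s , t) → pushout-unique right
               (trans u₁ (pushout-unique left
                 (trans v₁ (trans (sym s) (sym assoc)))
                 (trans v₂ (trans (∘-resp-≈ˡ (sym t)) (trans assoc
                   (trans (∘-resp-≈ʳ (sym (IsPushout.commute right))) (sym assoc)))))))
               (trans u₂ (sym t)) }

    pushout-cancel : k ∘ q₂ ≈ r ∘ h → IsPushout C f (h ∘ g) (k ∘ q₁) r → IsPushout C q₂ h k r
    pushout-cancel comm outer = record
      { commute   = comm
      ; universal = λ h₁ h₂ p →
          let u , u₁ , u₂ = pushout-desc outer {h₁ = h₁ ∘ q₁} {h₂ = h₂}
                              (trans assoc (trans (∘-resp-≈ʳ (IsPushout.commute left)) (extend p)))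
          in u , (pushout-unique left (trans assoc u₁)
                    (trans assoc (trans (∘-resp-≈ʳ comm) (trans (cancel C u₂) (sym p)))) , u₂) ,
             λ (s , t) → pushout-unique outer
               (trans u₁ (trans (∘-resp-≈ˡ (sym s)) assoc)) (trans u₂ (sym t)) }

  -- Turns the two pushouts that an iterated composition takes in succession into one pushout over
  -- the original `K`. Cancelling `R` from the outer pushout leaves a square that can be pasted to
  -- the first one.
  pushout-glue : ∀ {K B K̄ P K′ Z R Y} {f : K ⇒ B} {κ : K ⇒ K̄} {u : B ⇒ P} {v : K̄ ⇒ P}
    {α : K′ ⇒ K̄} {β : K′ ⇒ Z} {q₁ : K̄ ⇒ R} {q₂ : Z ⇒ R} {y₁ : P ⇒ Y} {y₂ : Z ⇒ Y} →
    IsPushout C f κ u v → IsPushout C α β q₁ q₂ → IsPushout C (v ∘ α) β y₁ y₂ →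
    Σ[ θ ∈ R ⇒ Y ] (IsPushout C f (q₁ ∘ κ) (y₁ ∘ u) θ × θ ∘ q₂ ≈ y₂)
  pushout-glue P-po R-po Y-po =
    let θ , θ₁ , θ₂ = pushout-desc R-po (trans assoc (IsPushout.commute Y-po))
    in θ , pushout-paste P-po (pushout-swap C (pushout-cancel (pushout-swap C R-po) θ₁
             (pushout-resp refl refl (sym θ₂) refl (pushout-swap C Y-po)))) , θ₂

  -- Isomorphisms induced between pushouts and between pullbacks

  module _ {A X Y Q A′ X′ Y′ Q′}
           {f : A ⇒ X} {g : A ⇒ Y} {q₁ : X ⇒ Q} {q₂ : Y ⇒ Q}
           {f′ : A′ ⇒ X′} {g′ : A′ ⇒ Y′} {q₁′ : X′ ⇒ Q′} {q₂′ : Y′ ⇒ Q′} where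

    abstract
      pushout-map : IsPushout C f g q₁ q₂ → IsPushout C f′ g′ q₁′ q₂′ →
        (α : Iso C A A′) (ξ : Iso C X X′) (υ : Iso C Y Y′) →
        Iso.to ξ ∘ f ≈ f′ ∘ Iso.to α → Iso.to υ ∘ g ≈ g′ ∘ Iso.to α →
        Σ[ φ ∈ Iso C Q Q′ ] (Iso.to φ ∘ q₁ ≈ q₁′ ∘ Iso.to ξ × Iso.to φ ∘ q₂ ≈ q₂′ ∘ Iso.to υ)
      pushout-map po po′ α ξ υ p q =
        let u , u₁ , u₂ = pushout-desc po {h₁ = q₁′ ∘ Iso.to ξ} {h₂ = q₂′ ∘ Iso.to υ}
              (trans assoc (trans (∘-resp-≈ʳ p) (trans (extend (IsPushout.commute po′))
                (trans (∘-resp-≈ʳ (sym q)) (sym assoc)))))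
            v , v₁ , v₂ = pushout-desc po′ {h₁ = q₁ ∘ Iso.from ξ} {h₂ = q₂ ∘ Iso.from υ}
              (trans assoc (trans (∘-resp-≈ʳ (square-sym C α ξ p)) (trans (extend (IsPushout.commute po))
                (trans (∘-resp-≈ʳ (sym (square-sym C α υ q))) (sym assoc)))))
        in record
          { to = u ; from = v
          ; isoˡ = pushout-unique po
              (trans (square-trans C u₁ v₁) (trans (trans (∘-resp-≈ʳ (Iso.isoˡ ξ)) identityʳ) (sym identityˡ)))
              (trans (square-trans C u₂ v₂) (trans (trans (∘-resp-≈ʳ (Iso.isoˡ υ)) identityʳ) (sym identityˡ)))
          ; isoʳ = pushout-unique po′
              (trans (square-trans C v₁ u₁) (trans (trans (∘-resp-≈ʳ (Iso.isoʳ ξ)) identityʳ) (sym identityˡ)))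
              (trans (square-trans C v₂ u₂) (trans (trans (∘-resp-≈ʳ (Iso.isoʳ υ)) identityʳ) (sym identityˡ)))
          } , u₁ , u₂

  module _ {P X Y Z P′ X′ Y′ Z′}
           {p₁ : P ⇒ X} {p₂ : P ⇒ Y} {f : X ⇒ Z} {g : Y ⇒ Z}
           {p₁′ : P′ ⇒ X′} {p₂′ : P′ ⇒ Y′} {f′ : X′ ⇒ Z′} {g′ : Y′ ⇒ Z′} where

    abstract
      pullback-map : IsPullback C p₁ p₂ f g → IsPullback C p₁′ p₂′ f′ g′ →
        (ξ : Iso C X X′) (υ : Iso C Y Y′) (ζ : Iso C Z Z′) →
        Iso.to ζ ∘ f ≈ f′ ∘ Iso.to ξ → Iso.to ζ ∘ g ≈ g′ ∘ Iso.to υ →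
        Σ[ φ ∈ Iso C P P′ ] (Iso.to ξ ∘ p₁ ≈ p₁′ ∘ Iso.to φ × Iso.to υ ∘ p₂ ≈ p₂′ ∘ Iso.to φ)
      pullback-map pb pb′ ξ υ ζ p q =
        let u , u₁ , u₂ = pullback-lift pb′ {h₁ = Iso.to ξ ∘ p₁} {h₂ = Iso.to υ ∘ p₂}
              (trans (extend (sym p)) (trans (∘-resp-≈ʳ (IsPullback.commute pb)) (extend q)))
            v , v₁ , v₂ = pullback-lift pb {h₁ = Iso.from ξ ∘ p₁′} {h₂ = Iso.from υ ∘ p₂′}
              (trans (extend (sym (square-sym C ξ ζ p))) (trans (∘-resp-≈ʳ (IsPullback.commute pb′))
                (extend (square-sym C υ ζ q))))
        in record
          { to = u ; from = v
          ; isoˡ = pullback-unique pb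
              (trans (sym (square-trans C (sym u₁) (sym v₁))) (trans (trans (∘-resp-≈ˡ (Iso.isoˡ ξ)) identityˡ) (sym identityʳ)))
              (trans (sym (square-trans C (sym u₂) (sym v₂))) (trans (trans (∘-resp-≈ˡ (Iso.isoˡ υ)) identityˡ) (sym identityʳ)))
          ; isoʳ = pullback-unique pb′
              (trans (sym (square-trans C (sym v₁) (sym u₁))) (trans (trans (∘-resp-≈ˡ (Iso.isoʳ ξ)) identityˡ) (sym identityʳ)))
              (trans (sym (square-trans C (sym v₂) (sym u₂))) (trans (trans (∘-resp-≈ˡ (Iso.isoʳ υ)) identityˡ) (sym identityʳ)))
          } , sym u₁ , sym u₂

-- Adhesive categories with final pullback complements

module AdhesiveLemmas {o ℓ e : Level} (C : Category o ℓ e) (adhesive : Adhesive C)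
    (hasFPCs : HasFPCsAlongMonos C) (stable : MonosStableUnderFPCs C) where
  open Category C
  open Equiv
  open Adhesive adhesive
  open SqPO C adhesive hasFPCs stable using (mono-pushout)
  open CategoryLemmas C

  mono-pushoutˡ : ∀ {A X Y Q} {f : A ⇒ X} {g : A ⇒ Y} {q₁ : X ⇒ Q} {q₂ : Y ⇒ Q} →
                  Mono C g → IsPushout C f g q₁ q₂ → Mono C q₁
  mono-pushoutˡ g-mono po = mono-pushout g-mono (pushout-swap C po)

  module _ {A X Y Q} {f : A ⇒ X} {g : A ⇒ Y} {q₁ : X ⇒ Q} {q₂ : Y ⇒ Q}
           (f-mono : Mono C f) (po : IsPushout C f g q₁ q₂) where

    -- The van Kampen cube with vertical arrows id, f, id, q₂.
    pushout-isPullback : IsPullback C f g q₁ q₂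
    pushout-isPullback = pullback-swap C (proj₁ (Equivalence.from cube (record
        { commute   = trans identityʳ (sym identityˡ)
        ; universal = λ h₁ h₂ q → h₂ , (trans (sym q) identityʳ , identityʳ) ,
            λ (_ , s) → trans (sym s) identityʳ })))
      where
        cube = vanKampen f-mono po id g g id id f id q₂
                 (trans identityʳ (sym identityˡ)) refl (trans identityˡ (sym identityʳ))
                 (sym (IsPushout.commute po)) refl
                 (record
                   { commute   = refl
                   ; universal = λ h₁ h₂ q → h₁ , (identityˡ , trans identityˡ (f-mono _ _ q)) ,
                       λ (r , _) → trans (sym r) identityˡ })
                 pullback-idˡ

    -- The second back face of the van Kampen cube is deduced: the front face over `q₁` pasted with
    -- `back₁` is a pullback over `q₁ ∘ f ≈ q₂ ∘ g`, from which the front face over `q₂` can be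
    -- cancelled.
    pushout-stable : ∀ {A′ X′ Y′ Q′} {f′ : A′ ⇒ X′} {g′ : A′ ⇒ Y′} {q₁′ : X′ ⇒ Q′} {q₂′ : Y′ ⇒ Q′}
      {a : A′ ⇒ A} {x : X′ ⇒ X} {y : Y′ ⇒ Y} {q : Q′ ⇒ Q} →
      q₁′ ∘ f′ ≈ q₂′ ∘ g′ → y ∘ g′ ≈ g ∘ a →
      IsPullback C f′ a x f → IsPullback C q₁′ x q q₁ → IsPullback C q₂′ y q q₂ →
      IsPushout C f′ g′ q₁′ q₂′
    pushout-stable top right back₁ front₁ front₂ =
      Equivalence.to (vanKampen f-mono po _ _ _ _ _ _ _ _ top
        (IsPullback.commute back₁) right (IsPullback.commute front₁) (IsPullback.commute front₂)
        back₁ back₂) (front₁ , front₂)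
      where
        back₂ = pullback-swap C (pullback-cancel (pullback-swap C front₂) (sym right)
          (pullback-resp refl top (IsPushout.commute po) refl
            (pullback-paste (pullback-swap C front₁) (pullback-swap C back₁))))

    pushout-front : ∀ {A′ X′ Y′ Q′} {f′ : A′ ⇒ X′} {g′ : A′ ⇒ Y′} {q₁′ : X′ ⇒ Q′} {q₂′ : Y′ ⇒ Q′}
      {a : A′ ⇒ A} {x : X′ ⇒ X} {y : Y′ ⇒ Y} {q : Q′ ⇒ Q} →
      q ∘ q₁′ ≈ q₁ ∘ x → q ∘ q₂′ ≈ q₂ ∘ y →
      IsPullback C f′ a x f → IsPullback C g′ a y g → IsPushout C f′ g′ q₁′ q₂′ →
      IsPullback C q₂′ y q q₂
    pushout-front front₁ front₂ back₁ back₂ top =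
      proj₂ (Equivalence.from (vanKampen f-mono po _ _ _ _ _ _ _ _ (IsPushout.commute top)
        (IsPullback.commute back₁) (IsPullback.commute back₂) front₁ front₂ back₁ back₂) top)

    -- The element `z` itself may lie in neither leg. Its domain is instead presented as a pushout
    -- of two pieces on which it does, which is what permits arguing by cases.
    record Cover {F} (z : F ⇒ Q) : Set (o ⊔ ℓ ⊔ e) where
      field
        {A′ X′ Y′} : Obj
        {f′}       : A′ ⇒ X′
        {g′}       : A′ ⇒ Y′
        {c₁}       : X′ ⇒ F
        {c₂}       : Y′ ⇒ F
        isPushout  : IsPushout C f′ g′ c₁ c₂
        factor₁    : z ∘ c₁ ⊑ q₁
        factor₂    : z ∘ c₂ ⊑ q₂

    cover : ∀ {F} (z : F ⇒ Q) → Cover z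
    cover z = record
      { isPushout = pushout-stable (sym (proj₂ lift₂)) (proj₁ lift₂) (Pullback.isPullback PA)
                      (Pullback.isPullback PX) (Pullback.isPullback PY)
      ; factor₁ = Pullback.p₂ PX , sym (IsPullback.commute (Pullback.isPullback PX))
      ; factor₂ = Pullback.p₂ PY , sym (IsPullback.commute (Pullback.isPullback PY)) }
      where
        PX = pullback z q₁
        PY = pullback z q₂
        PA = pullback (Pullback.p₂ PX) f
        open HomReasoning
        lift = pullback-lift (pullback-swap C (Pullback.isPullback PY))
          {h₁ = g ∘ Pullback.p₂ PA} {h₂ = Pullback.p₁ PX ∘ Pullback.p₁ PA} (begin
            q₂ ∘ (g ∘ Pullback.p₂ PA)               ≈⟨ extend (IsPushout.commute po) ⟨
            q₁ ∘ (f ∘ Pullback.p₂ PA)               ≈⟨ ∘-resp-≈ʳ (IsPullback.commute (Pullback.isPullback PA)) ⟨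
            q₁ ∘ (Pullback.p₂ PX ∘ Pullback.p₁ PA)  ≈⟨ extend (IsPullback.commute (Pullback.isPullback PX)) ⟨
            z ∘ (Pullback.p₁ PX ∘ Pullback.p₁ PA)   ∎)
        lift₂ = proj₂ lift

    cover-≈ : ∀ {F W} (z : F ⇒ Q) {h k : F ⇒ W} →
      (∀ {G} (g : G ⇒ F) → z ∘ g ⊑ q₁ → h ∘ g ≈ k ∘ g) →
      (∀ {G} (g : G ⇒ F) → z ∘ g ⊑ q₂ → h ∘ g ≈ k ∘ g) → h ≈ k
    cover-≈ z p₁ p₂ = pushout-unique isPushout (p₁ _ factor₁) (p₂ _ factor₂)
      where open Cover (cover z)

    cover-⊑ : ∀ {F W D} (z : F ⇒ Q) {ζ : F ⇒ W} {d : D ⇒ W} → Mono C d →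
      (∀ {G} (g : G ⇒ F) → z ∘ g ⊑ q₁ → ζ ∘ g ⊑ d) →
      (∀ {G} (g : G ⇒ F) → z ∘ g ⊑ q₂ → ζ ∘ g ⊑ d) → ζ ⊑ d
    cover-⊑ z d-mono p₁ p₂ = pushout-⊑ isPushout d-mono (p₁ _ factor₁) (p₂ _ factor₂)
      where open Cover (cover z)

  -- Unions of subobjects

  -- Split `k` into its parts in `A` and in `B`. On the first, `u` monic gives equality; on the
  -- second, the factors of `h` and `k` form an element of the intersection `P`, where the pushout
  -- identifies the two legs.
  union-agree : ∀ {A B T P U} {u : A ⇒ T} {v : B ⇒ T} {p₁ : P ⇒ A} {p₂ : P ⇒ B}
    {q₁ : A ⇒ U} {q₂ : B ⇒ U} {w : U ⇒ T} → Mono C u → Mono C v →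
    IsPullback C p₁ p₂ u v → IsPushout C p₁ p₂ q₁ q₂ → w ∘ q₁ ≈ u → w ∘ q₂ ≈ v →
    ∀ {X} {h k : X ⇒ U} → w ∘ h ≈ w ∘ k → h ⊑ q₁ → h ≈ k
  union-agree {u = u} {v} {p₁} {p₂} {q₁} {q₂} {w} u-mono v-mono pb po w₁ w₂ {h = h} {k} p (a , q) =
    cover-≈ (mono-pullbackʳ pb v-mono) po k
      (λ g (b , r) →
        let a≈b = u-mono (a ∘ g) b (trans (sym (via w₁ q g)) (trans (same g) (trans (∘-resp-≈ʳ (sym r)) (cancel C w₁))))
        in trans (∘-resp-≈ˡ (sym q)) (trans assoc (trans (∘-resp-≈ʳ a≈b) r)))
      (λ g (b , r) →
        let π , s , t = pullback-lift pb {h₁ = a ∘ g} {h₂ = b}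
              (trans (sym (via w₁ q g)) (trans (same g) (trans (∘-resp-≈ʳ (sym r)) (cancel C w₂))))
        in trans (∘-resp-≈ˡ (sym q)) (trans assoc (trans (∘-resp-≈ʳ (sym s))
             (trans (extend (IsPushout.commute po)) (trans (∘-resp-≈ʳ t) r)))))
    where
      same : ∀ {G} (g : G ⇒ _) → w ∘ (h ∘ g) ≈ w ∘ (k ∘ g)
      same g = extend p
      via : ∀ {A′ u′} {q′ : A′ ⇒ _} {a′ : _ ⇒ A′} → w ∘ q′ ≈ u′ → q′ ∘ a′ ≈ h →
            ∀ {G} (g : G ⇒ _) → w ∘ (h ∘ g) ≈ u′ ∘ (a′ ∘ g)
      via w′ q′ g = trans (∘-resp-≈ʳ (trans (∘-resp-≈ˡ (sym q′)) assoc)) (cancel C w′)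

  module _ {A B T P U} {u : A ⇒ T} {v : B ⇒ T} {p₁ : P ⇒ A} {p₂ : P ⇒ B}
    {q₁ : A ⇒ U} {q₂ : B ⇒ U} (u-mono : Mono C u) (v-mono : Mono C v)
    (pb : IsPullback C p₁ p₂ u v) (po : IsPushout C p₁ p₂ q₁ q₂) where

    union-mono : ∀ {w : U ⇒ T} → w ∘ q₁ ≈ u → w ∘ q₂ ≈ v → Mono C w
    union-mono w₁ w₂ h k p =
      cover-≈ (mono-pullbackʳ pb v-mono) po h
        (λ g → union-agree u-mono v-mono pb po w₁ w₂ (extend p))
        (λ g → union-agree v-mono u-mono (pullback-swap C pb) (pushout-swap C po) w₂ w₁ (extend p))

    -- Unions are effective: the pushout over the intersection embeds into `T` by `w`, and a
    -- subobject containing both `u` and `v` is everything by assumption, so `w` is invertible.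
    union-isPushout : (∀ {X} {d : X ⇒ T} → Mono C d → u ⊑ d → v ⊑ d → id ⊑ d) →
                      IsPushout C p₁ p₂ u v
    union-isPushout covers = pushout-iso po (retract-iso w w-mono (covers w-mono (q₁ , w₁) (q₂ , w₂))) w₁ w₂
      where
        desc = pushout-desc po (IsPullback.commute pb)
        w = proj₁ desc
        w₁ = proj₁ (proj₂ desc)
        w₂ = proj₂ (proj₂ desc)
        w-mono = union-mono w₁ w₂

  -- Final pullback complements

  module _ {A B D E} {c : B ⇒ E} {a : A ⇒ B} {d : D ⇒ E} {b : A ⇒ D} where

    -- For monos the finality condition says that d contains every z whose
    -- generalized elements lying in B already lie in A.
    fpc-intro : Mono C d → IsPullback C a b c d →
      (∀ {F} (z : F ⇒ E) → (∀ {G} (g : G ⇒ F) (h : G ⇒ B) → z ∘ g ≈ c ∘ h → h ⊑ a) → z ⊑ d) →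
      IsFPC C c a d b
    fpc-intro d-mono pb lift = record
      { isPullback = pb
      ; final = λ x y z w pbz p →
          let w* , q = lift z (λ g h r → ⊑-trans (pullback-⊑₁ pbz (sym r)) (w , p))
          in w* , (q , d-mono _ _ (trans (cancel C q) (trans (sym (IsPullback.commute pbz))
                         (trans (∘-resp-≈ʳ (sym p)) (extend (IsPullback.commute pb)))))) ,
             λ (r , _) → d-mono _ _ (trans q (sym r)) }

    abstract
      -- Converse of `fpc-intro`. One instance of the hypothesis is enough, the universal element of
      -- `B` lying under `z`, that is, the pullback of `c` and `z`.
      fpc-⊑ : IsFPC C c a d b → ∀ {F} (z : F ⇒ E) →
        (∀ {G} (g : G ⇒ F) (h : G ⇒ B) → z ∘ g ≈ c ∘ h → h ⊑ a) → z ⊑ d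
      fpc-⊑ fpc z avoid =
        let w , p = avoid p₂ p₁ (sym (IsPullback.commute isPullback))
            w* , (q , _) , _ = IsFPC.final fpc p₁ p₂ z w isPullback p
        in w* , q
        where open Pullback (pullback c z)

    fpc-element : IsFPC C c a d b → ∀ {G} {h : G ⇒ B} → c ∘ h ⊑ d → h ⊑ a
    fpc-element fpc (u , p) = pullback-⊑₁ (IsFPC.isPullback fpc) (sym p)

  abstract
    -- Cover `z` by its parts in `X` and in `Y`. The part in `X` lies in `A` by hypothesis, hence
    -- also in `Y`.
    pushout-fpc : ∀ {A X Y Q} {f : A ⇒ X} {g : A ⇒ Y} {q₁ : X ⇒ Q} {q₂ : Y ⇒ Q} →
      Mono C f → IsPushout C f g q₁ q₂ → IsFPC C q₁ f q₂ g
    pushout-fpc {q₂ = q₂} f-mono po =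
      fpc-intro (mono-pushout f-mono po) (pushout-isPullback f-mono po) λ z avoid →
        cover-⊑ f-mono po z (mono-pushout f-mono po)
          (λ g (h , p) → let w , q = avoid g h (sym p) in
            _ , trans (extend (sym (IsPushout.commute po))) (trans (∘-resp-≈ʳ q) p))
          (λ g p → p)

  abstract
    fpc-compose : ∀ {A B D E D′ E′} {c : B ⇒ E} {a : A ⇒ B} {d : D ⇒ E} {b : A ⇒ D}
      {c′ : E ⇒ E′} {d′ : D′ ⇒ E′} {b′ : D ⇒ D′} → Mono C d′ →
      IsFPC C c a d b → IsFPC C c′ d d′ b′ → IsFPC C (c′ ∘ c) a d′ (b′ ∘ b)
    fpc-compose d′-mono fpc fpc′ =
      fpc-intro d′-mono (pullback-paste (IsFPC.isPullback fpc′) (IsFPC.isPullback fpc)) λ z avoid →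
        fpc-⊑ fpc′ z λ g h p → fpc-⊑ fpc h λ g′ h′ q →
          avoid (g ∘ g′) h′ (trans (sym assoc) (trans (∘-resp-≈ˡ p) (trans assoc (trans (∘-resp-≈ʳ q) (sym assoc)))))

  module _ {A B D E A′ B′ D′ E′} {c : B ⇒ E} {a : A ⇒ B} {d : D ⇒ E} {b : A ⇒ D}
           {c′ : B′ ⇒ E′} {a′ : A′ ⇒ B′} {d′ : D′ ⇒ E′} {b′ : A′ ⇒ D′} where

    abstract
      fpc-map⊑ : IsFPC C c a d b → IsFPC C c′ a′ d′ b′ →
        (α : Iso C A A′) (β : Iso C B B′) (γ : Iso C E E′) →
        Iso.to β ∘ a ≈ a′ ∘ Iso.to α → Iso.to γ ∘ c ≈ c′ ∘ Iso.to β →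
        Iso.to γ ∘ d ⊑ d′
      fpc-map⊑ fpc fpc′ α β γ p q = fpc-⊑ fpc′ (Iso.to γ ∘ d) λ g h r →
        let w , s = pullback-⊑₁ (IsFPC.isPullback fpc) {h₁ = Iso.from β ∘ h} {h₂ = g}
              (trans (extend (sym (square-sym C β γ q))) (trans (∘-resp-≈ʳ (trans (sym r) assoc))
                (trans (cancel C (Iso.isoˡ γ)) identityˡ)))
        in Iso.to α ∘ w , trans (extend (sym p)) (trans (∘-resp-≈ʳ s) (trans (cancel C (Iso.isoʳ β)) identityˡ))

  module _ {A B D E A′ B′ D′ E′} {c : B ⇒ E} {a : A ⇒ B} {d : D ⇒ E} {b : A ⇒ D}
           {c′ : B′ ⇒ E′} {a′ : A′ ⇒ B′} {d′ : D′ ⇒ E′} {b′ : A′ ⇒ D′} where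

    abstract
      fpc-map : Mono C d → Mono C d′ → IsFPC C c a d b → IsFPC C c′ a′ d′ b′ →
        (α : Iso C A A′) (β : Iso C B B′) (γ : Iso C E E′) →
        Iso.to β ∘ a ≈ a′ ∘ Iso.to α → Iso.to γ ∘ c ≈ c′ ∘ Iso.to β →
        Σ[ φ ∈ Iso C D D′ ] (Iso.to γ ∘ d ≈ d′ ∘ Iso.to φ × Iso.to φ ∘ b ≈ b′ ∘ Iso.to α)
      fpc-map d-mono d′-mono fpc fpc′ α β γ p q =
        let u , r = fpc-map⊑ fpc fpc′ α β γ p q
            v , s = fpc-map⊑ fpc′ fpc (iso-sym C α) (iso-sym C β) (iso-sym C γ)
                      (square-sym C α β p) (square-sym C β γ q)
        in record
          { to = u ; from = v
          ; isoˡ = d-mono _ _ (trans (cancel C s) (trans assoc (trans (∘-resp-≈ʳ r)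
                     (trans (cancel C (Iso.isoˡ γ)) (trans identityˡ (sym identityʳ))))))
          ; isoʳ = d′-mono _ _ (trans (cancel C r) (trans assoc (trans (∘-resp-≈ʳ s)
                     (trans (cancel C (Iso.isoʳ γ)) (trans identityˡ (sym identityʳ))))))
          } , sym r ,
          d′-mono _ _ (trans (cancel C r) (trans assoc (trans (∘-resp-≈ʳ (sym (IsPullback.commute (IsFPC.isPullback fpc))))
            (trans (extend q) (trans (∘-resp-≈ʳ p) (extend (IsPullback.commute (IsFPC.isPullback fpc′))))))))

  fpc-iso : ∀ {A B D E E′} {c : B ⇒ E} {a : A ⇒ B} {d : D ⇒ E} {b : A ⇒ D} {c′ : B ⇒ E′} →
    Mono C a → Mono C d → IsFPC C c a d b → (φ : Iso C E E′) → Iso.to φ ∘ c ≈ c′ → IsFPC C c′ a (Iso.to φ ∘ d) b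
  fpc-iso a-mono d-mono fpc φ p = fpc-intro d′-mono
    (pullback-intro a-mono d′-mono
      (trans (∘-resp-≈ˡ (sym p)) (trans assoc (trans (∘-resp-≈ʳ (IsPullback.commute (IsFPC.isPullback fpc))) (sym assoc))))
      λ h₁ h₂ r → pullback-⊑₁ (IsFPC.isPullback fpc)
        (iso-mono φ _ _ (trans (cancel C p) (trans r assoc))))
    λ z avoid →
      let u , q = fpc-⊑ fpc (Iso.from φ ∘ z) λ g h r → avoid g h
            (iso-mono (iso-sym C φ) _ _ (trans (sym assoc) (trans r (trans (sym (trans (cancel C (Iso.isoˡ φ)) identityˡ))
              (∘-resp-≈ʳ (cancel C p))))))
      in u , trans assoc (trans (∘-resp-≈ʳ q) (trans (cancel C (Iso.isoʳ φ)) identityˡ))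
    where
      d′-mono = mono-∘ C (iso-mono φ) d-mono

  -- A complement of `X` in `Q` restricts to any subobject `N` that contains `X`: pull the pushout
  -- back along `a`. The faces over `X` and `A` are trivial because `X` already lies in `N`. This
  -- makes the first matches read off a middle object admissible.
  pushout-restrict : ∀ {A X Y Q N K̄} {f : A ⇒ X} {g : A ⇒ Y} {q₁ : X ⇒ Q} {q₂ : Y ⇒ Q}
    {n : X ⇒ N} {a : N ⇒ Q} {ι : K̄ ⇒ N} {r : K̄ ⇒ Y} → Mono C f → Mono C a →
    IsPushout C f g q₁ q₂ → a ∘ n ≈ q₁ → IsPullback C ι r a q₂ →
    Σ[ κ ∈ A ⇒ K̄ ] (IsPushout C f κ n ι × r ∘ κ ≈ g)
  pushout-restrict {f = f} {g} {n = n} f-mono a-mono po p pb =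
    let κ , s , t = pullback-lift pb {h₁ = n ∘ f} {h₂ = g} (trans (cancel C p) (IsPushout.commute po))
    in κ , pushout-stable f-mono po (sym s) (trans t (sym identityʳ))
             pullback-idˡ
             (pullback-resp refl refl refl p (pullback-mono a-mono)) pb , t

-- Compatible diagrams around a common middle object

module Diagrams {o ℓ e : Level} (C : Category o ℓ e) (adhesive : Adhesive C)
    (hasFPCs : HasFPCsAlongMonos C) (stable : MonosStableUnderFPCs C) where
  open Category C
  open Equiv
  open HomReasoning
  open Adhesive adhesive
  open SqPO C adhesive hasFPCs stable using (mono-pushout)
  open CategoryLemmas C
  open AdhesiveLemmas C adhesive hasFPCs stable

  flip : LinearRule C → LinearRule C
  flip p = record { outₗ = inₗ ; inₗ = outₗ ; out-mono = in-mono ; in-mono = out-mono }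
    where open LinearRule p

  -- The part of a composition diagram that involves p and the object E of the
  -- other rule along which p is matched.  The composition p₂ ∘ p₁ gives such a
  -- diagram for p₂ and O₁, and the composition p₃ ∘ p₂ gives one for flip p₂
  -- and I₃, because its pushout complement is an FPC.
  record Base (p : LinearRule C) (E : Obj) : Set (o ⊔ ℓ ⊔ e) where
    private module p = LinearRule p
    field
      {M N K̄ P}   : Obj
      x           : M ⇒ p.I
      y           : M ⇒ E
      x-mono      : Mono C x
      y-mono      : Mono C y
      nI          : p.I ⇒ N
      nE          : E ⇒ N
      N-isPushout : IsPushout C x y nI nE
      ι           : K̄ ⇒ N
      κ           : p.K ⇒ K̄
      K̄-isFPC     : IsFPC C nI p.inₗ ι κ
      u           : p.O ⇒ P
      v           : K̄ ⇒ P
      P-isPushout : IsPushout C p.outₗ κ u v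

    nI-mono : Mono C nI
    nI-mono = mono-pushoutˡ y-mono N-isPushout

    nE-mono : Mono C nE
    nE-mono = mono-pushout x-mono N-isPushout

    ι-mono : Mono C ι
    ι-mono = proj₁ (stable nI-mono p.in-mono K̄-isFPC)

    κ-mono : Mono C κ
    κ-mono = proj₂ (stable nI-mono p.in-mono K̄-isFPC)

    v-mono : Mono C v
    v-mono = mono-pushout p.out-mono P-isPushout

  -- T and S are the objects in which the input and the output of p are glued
  -- to the outputs and inputs of the neighbouring rules.  This notion is
  -- symmetric under exchange of input and output.
  record Frame (p : LinearRule C) (E E′ : Obj) : Set (o ⊔ ℓ ⊔ e) where
    private module p = LinearRule p
    field
      {T S Q}  : Obj
      i        : p.I ⇒ T
      j        : E ⇒ T
      i′       : p.O ⇒ S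
      j′       : E′ ⇒ S
      t        : Q ⇒ T
      s        : Q ⇒ S
      k        : p.K ⇒ Q
      i-mono   : Mono C i
      j-mono   : Mono C j
      i′-mono  : Mono C i′
      j′-mono  : Mono C j′
      t-isFPC  : IsFPC C i p.inₗ t k
      s-isFPC  : IsFPC C i′ p.outₗ s k

    t-mono : Mono C t
    t-mono = proj₁ (stable i-mono p.in-mono t-isFPC)

    s-mono : Mono C s
    s-mono = proj₁ (stable i′-mono p.out-mono s-isFPC)

  flipFrame : ∀ {p E E′} → Frame p E E′ → Frame (flip p) E′ E
  flipFrame F = record
    { i = i′ ; j = j′ ; i′ = i ; j′ = j ; t = s ; s = t ; k = k
    ; i-mono = i′-mono ; j-mono = j′-mono ; i′-mono = i-mono ; j′-mono = j-mono
    ; t-isFPC = s-isFPC ; s-isFPC = t-isFPC }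
    where open Frame F

  record Embedding {p E E′} (F : Frame p E E′) (B : Base p E) : Set (o ⊔ ℓ ⊔ e) where
    private module p = LinearRule p
    open Frame F
    open Base B
    field
      a            : N ⇒ T
      q            : K̄ ⇒ Q
      c            : P ⇒ S
      a-mono       : Mono C a
      a∘nI         : a ∘ nI ≈ i
      a∘nE         : a ∘ nE ≈ j
      c∘u          : c ∘ u ≈ i′
      c∘v          : c ∘ v ≈ s ∘ q
      K̄-isPullback : IsPullback C ι q a t

    q-mono : Mono C q
    q-mono = mono-pullback C K̄-isPullback a-mono

    q∘κ : q ∘ κ ≈ k
    q∘κ = t-mono _ _ (begin
      t ∘ (q ∘ κ)           ≈⟨ extend (IsPullback.commute K̄-isPullback) ⟨
      a ∘ (ι ∘ κ)           ≈⟨ ∘-resp-≈ʳ (IsPullback.commute (IsFPC.isPullback K̄-isFPC)) ⟨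
      a ∘ (nI ∘ p.inₗ)      ≈⟨ cancel C a∘nI ⟩
      i ∘ p.inₗ             ≈⟨ IsPullback.commute (IsFPC.isPullback t-isFPC) ⟩
      t ∘ k                 ∎)

    x-isPullback : IsPullback C x y i j
    x-isPullback = pullback-intro x-mono j-mono
      (trans (∘-resp-≈ˡ (sym a∘nI)) (trans assoc (trans (∘-resp-≈ʳ (IsPushout.commute N-isPushout)) (cancel C a∘nE))))
      λ h₁ h₂ p → pullback-⊑₁ (pushout-isPullback x-mono N-isPushout)
        (a-mono _ _ (trans (cancel C a∘nI) (trans p (sym (cancel C a∘nE)))))

    -- `P` is glued from `O` and `K̄` along `K`, and in `S` these two meet in nothing more than `K`,
    -- because `O` and `Q` already meet in `K`. So `P` is their union.
    c-mono : Mono C c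
    c-mono = union-mono i′-mono (mono-∘ C s-mono q-mono)
      (pullback-intro p.out-mono (mono-∘ C s-mono q-mono)
        (trans (IsPullback.commute (IsFPC.isPullback s-isFPC)) (trans (∘-resp-≈ʳ (sym q∘κ)) (sym assoc)))
        λ h₁ h₂ r → pullback-⊑₁ (IsFPC.isPullback s-isFPC) (trans r assoc))
      P-isPushout c∘u c∘v

    -- The pullback half uses that `O` and `Q` meet in `K` inside `S`, the finality half that `O`
    -- and `K̄` meet in `K` inside `P`. Hence `Q` is determined by `c` and `v`, which is how
    -- `frameOf` obtains it and how `frameIso` compares two of them.
    v-isFPC : IsFPC C c v s q
    v-isFPC = fpc-intro s-mono
      (pullback-intro v-mono s-mono c∘v λ h₁ h₂ r → cover-⊑ p.out-mono P-isPushout h₁ v-mono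
        (λ g (h , w) →
          let π , z = pullback-⊑₁ (IsFPC.isPullback s-isFPC) {h₁ = h} {h₂ = h₂ ∘ g}
                (trans (sym (cancel C c∘u)) (trans (∘-resp-≈ʳ w) (extend r)))
          in κ ∘ π , trans (extend (sym (IsPushout.commute P-isPushout))) (trans (∘-resp-≈ʳ z) w))
        (λ g w → w))
      λ z avoid → fpc-⊑ s-isFPC z λ g h r →
        let π , w = avoid g (u ∘ h) (trans r (sym (cancel C c∘u)))
        in pullback-⊑₁ (pushout-isPullback p.out-mono P-isPushout) (sym w)

  -- That the match is the intersection of `i` and `j` is all that must be supplied: effective
  -- unions embed `N` in `T`, finality of `t` sends `K̄` into `Q`, and finality of `ι` gives
  -- `K̄ = N ∩ Q`.
  embed : ∀ {p E E′} (F : Frame p E E′) (B : Base p E) →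
          IsPullback C (Base.x B) (Base.y B) (Frame.i F) (Frame.j F) → Embedding F B
  embed {p} F B pb = record
    { a = a ; q = q ; c = proj₁ P-desc ; a-mono = a-mono
    ; a∘nI = a∘nI ; a∘nE = proj₂ (proj₂ N-desc)
    ; c∘u = proj₁ (proj₂ P-desc) ; c∘v = proj₂ (proj₂ P-desc)
    ; K̄-isPullback = pullback-intro ι-mono t-mono (sym t∘q) λ h₁ h₂ r →
        fpc-⊑ K̄-isFPC h₁ λ g h z → pullback-⊑₁ (IsFPC.isPullback t-isFPC) {h₂ = h₂ ∘ g}
          (trans (sym (cancel C a∘nI)) (trans (∘-resp-≈ʳ (sym z)) (extend r))) }
    where
      module p = LinearRule p
      open Frame F
      open Base B
      N-desc = pushout-desc N-isPushout (IsPullback.commute pb)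
      a = proj₁ N-desc
      a∘nI = proj₁ (proj₂ N-desc)
      a-mono = union-mono i-mono j-mono pb N-isPushout a∘nI (proj₂ (proj₂ N-desc))
      q-lift : a ∘ ι ⊑ t
      q-lift = fpc-⊑ t-isFPC (a ∘ ι) λ g h r → pullback-⊑₁ (IsFPC.isPullback K̄-isFPC)
        (a-mono _ _ (trans (cancel C a∘nI) (trans (sym r) assoc)))
      q = proj₁ q-lift
      t∘q = proj₂ q-lift
      q∘κ : q ∘ κ ≈ k
      q∘κ = t-mono _ _ (begin
        t ∘ (q ∘ κ)           ≈⟨ extend t∘q ⟩
        a ∘ (ι ∘ κ)           ≈⟨ ∘-resp-≈ʳ (IsPullback.commute (IsFPC.isPullback K̄-isFPC)) ⟨
        a ∘ (nI ∘ p.inₗ)      ≈⟨ cancel C a∘nI ⟩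
        i ∘ p.inₗ             ≈⟨ IsPullback.commute (IsFPC.isPullback t-isFPC) ⟩
        t ∘ k                 ∎)
      P-desc = pushout-desc P-isPushout {h₁ = i′} {h₂ = s ∘ q}
        (trans (IsPullback.commute (IsFPC.isPullback s-isFPC)) (trans (∘-resp-≈ʳ (sym q∘κ)) (sym assoc)))

  -- x′ and y′ form the match of the second composition, whose pushout is the
  -- object S of a frame.
  record Half (p : LinearRule C) (E E′ : Obj) : Set (o ⊔ ℓ ⊔ e) where
    field
      base : Base p E
    open Base base public
    field
      {M′}    : Obj
      x′      : M′ ⇒ E′
      y′      : M′ ⇒ P
      x′-mono : Mono C x′
      y′-mono : Mono C y′

  record Fits {p E E′} (F : Frame p E E′) (H : Half p E E′) : Set (o ⊔ ℓ ⊔ e) where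
    open Frame F
    open Half H
    field
      embedding : Embedding F base
    open Embedding embedding public
    field
      T-isPushout : IsPushout C ι q a t
      S-isPushout : IsPushout C x′ y′ j′ c

  -- Exchanging the two sides of a frame

  module _ {p E E′} {F : Frame p E E′} {H : Half p E E′} (fits : Fits F H)
           {B° : Base (flip p) E′} (embedding° : Embedding (flipFrame F) B°) where
    private module p = LinearRule p
    open Frame F
    open Half H
    open Fits fits
    private
      module B° = Base B°
      module E° = Embedding embedding°

    -- `S` is the union of `E′`, `O` and `K̄`. The first two lie in `B°.N` and the third lies in
    -- `Q`.
    opposite-isPushout : IsPushout C B°.ι E°.q E°.a s
    opposite-isPushout = union-isPushout E°.a-mono s-mono E°.K̄-isPullback
      (Pushout.isPushout (pushout B°.ι E°.q B°.ι-mono))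
      λ d-mono a⊑d s⊑d → pushout-id⊑ S-isPushout d-mono
        (⊑-respˡ E°.a∘nE (⊑-pre a⊑d))
        (pushout-⊑ P-isPushout d-mono
          (⊑-respˡ (sym c∘u) (⊑-respˡ E°.a∘nI (⊑-pre a⊑d)))
          (⊑-respˡ (sym c∘v) (⊑-pre s⊑d)))

    -- Let X be a subobject of T that contains the images of P° and E, and let
    -- Y = X ∩ Q.  The pushout V of Y and N° is a subobject of S which contains
    -- the images of P and E′.  Hence V = S, so that Y = Q, and X contains Q.
    opposite-covers : ∀ {X} {d : X ⇒ T} → Mono C d → E°.c ⊑ d → j ⊑ d → id ⊑ d
    opposite-covers {d = d} d-mono c°⊑d j⊑d = pushout-id⊑ T-isPushout d-mono a⊑d t⊑d
      where
        i⊑d : i ⊑ d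
        i⊑d = ⊑-respˡ E°.c∘u (⊑-pre c°⊑d)

        a⊑d : a ⊑ d
        a⊑d = pushout-⊑ N-isPushout d-mono (⊑-respˡ (sym a∘nI) i⊑d) (⊑-respˡ (sym a∘nE) j⊑d)

        module Y = Pullback (pullback d t)
        y-inc = Y.p₂

        y-mono′ : Mono C y-inc
        y-mono′ = mono-pullback C Y.isPullback d-mono

        in-Y : ∀ {G} {z : G ⇒ Q} → t ∘ z ⊑ d → z ⊑ y-inc
        in-Y (w , r) = pullback-⊑₂ Y.isPullback r

        q⊑y : q ⊑ y-inc
        q⊑y = in-Y (⊑-respˡ (IsPullback.commute K̄-isPullback) (⊑-pre a⊑d))

        q°⊑y : E°.q ⊑ y-inc
        q°⊑y = in-Y (⊑-respˡ E°.c∘v (⊑-pre c°⊑d))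

        module V = Pushout (pushout B°.ι (proj₁ q°⊑y) B°.ι-mono)
        ψ-desc = pushout-desc V.isPushout {h₁ = E°.a} {h₂ = s ∘ y-inc}
          (trans (IsPullback.commute E°.K̄-isPullback) (trans (∘-resp-≈ʳ (sym (proj₂ q°⊑y))) (sym assoc)))
        ψ = proj₁ ψ-desc
        ψ∘q₁ = proj₁ (proj₂ ψ-desc)
        ψ∘q₂ = proj₂ (proj₂ ψ-desc)

        -- `V` is cancelled from `opposite-isPushout`. As `y-inc` is monic, so is `ψ`; and since the
        -- square is also a pullback, `Y = V ∩ Q`, which turns `id⊑ψ` into `id⊑y`.
        ψ-isPushout : IsPushout C V.q₂ y-inc ψ s
        ψ-isPushout = pushout-cancel V.isPushout ψ∘q₂
          (pushout-resp refl (sym (proj₂ q°⊑y)) (sym ψ∘q₁) refl opposite-isPushout)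

        ψ-mono : Mono C ψ
        ψ-mono = mono-pushoutˡ y-mono′ ψ-isPushout

        a°⊑ψ : E°.a ⊑ ψ
        a°⊑ψ = V.q₁ , ψ∘q₁

        id⊑ψ : id ⊑ ψ
        id⊑ψ = pushout-id⊑ S-isPushout ψ-mono
          (⊑-respˡ E°.a∘nE (⊑-pre a°⊑ψ))
          (pushout-⊑ P-isPushout ψ-mono
            (⊑-respˡ (sym c∘u) (⊑-respˡ E°.a∘nI (⊑-pre a°⊑ψ)))
            (⊑-respˡ (trans (∘-resp-≈ʳ (proj₂ q⊑y)) (sym c∘v))
              (⊑-respˡ (trans (cancel C ψ∘q₂) assoc) (⊑-intro {u = V.q₂ ∘ proj₁ q⊑y}))))

        id⊑y : id ⊑ y-inc
        id⊑y = pullback-⊑₁ (pullback-swap C (pushout-isPullback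
                 (mono-first (mono-resp (sym ψ∘q₂) (mono-∘ C s-mono y-mono′))) ψ-isPushout))
          (sym (trans (cancel C (proj₂ id⊑ψ)) (trans identityˡ (sym identityʳ))))

        t⊑d : t ⊑ d
        t⊑d = Y.p₁ ∘ proj₁ id⊑y , trans (extend (IsPullback.commute Y.isPullback))
                (trans (∘-resp-≈ʳ (proj₂ id⊑y)) identityʳ)

    opposite-fits : ∀ {M′} {x′ : M′ ⇒ E} {y′ : M′ ⇒ B°.P} (x′-mono : Mono C x′) (y′-mono : Mono C y′) →
      IsPullback C x′ y′ j E°.c →
      Fits (flipFrame F) (record { base = B° ; x′ = x′ ; y′ = y′ ; x′-mono = x′-mono ; y′-mono = y′-mono })
    opposite-fits {x′ = x″} {y″} x″-mono y″-mono pb = record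
      { embedding   = embedding°
      ; T-isPushout = opposite-isPushout
      ; S-isPushout = union-isPushout j-mono E°.c-mono pb (Pushout.isPushout (pushout x″ y″ x″-mono))
          λ d-mono j⊑d c⊑d → opposite-covers d-mono c⊑d j⊑d }

  module _ {p E E′} (H : Half p E E′) where
    private module p = LinearRule p
    open Half H

    abstract
      -- `S` comes from the second match, `Q` is the FPC of `K̄ → P → S`, and `T` glues `N` to `Q`
      -- along `K̄`. Each of `t` and `s` is then an FPC pasted with a pushout, hence an FPC by
      -- `fpc-compose`.
      frameOf : ∀ {S} (j′ : E′ ⇒ S) (c : P ⇒ S) → IsPushout C x′ y′ j′ c → Σ[ F ∈ Frame p E E′ ] Fits F H
      frameOf {S} j′ c S-po = record
        { i = TP.q₁ ∘ nI ; j = TP.q₁ ∘ nE ; i′ = c ∘ u ; j′ = j′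
        ; t = TP.q₂ ; s = Q.d ; k = Q.b ∘ κ
        ; i-mono = mono-∘ C a-mono nI-mono ; j-mono = mono-∘ C a-mono nE-mono
        ; i′-mono = mono-∘ C c-mono (mono-pushoutˡ κ-mono P-isPushout)
        ; j′-mono = mono-pushoutˡ y′-mono S-po
        ; t-isFPC = fpc-compose (mono-pushout ι-mono TP.isPushout) K̄-isFPC (pushout-fpc ι-mono TP.isPushout)
        ; s-isFPC = fpc-compose (proj₁ Q-monos) (pushout-fpc p.out-mono P-isPushout) Q.isFPC } , record
        { embedding = record
            { a = TP.q₁ ; q = Q.b ; c = c ; a-mono = a-mono
            ; a∘nI = refl ; a∘nE = refl ; c∘u = refl ; c∘v = IsPullback.commute (IsFPC.isPullback Q.isFPC)
            ; K̄-isPullback = pushout-isPullback ι-mono TP.isPushout }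
        ; T-isPushout = TP.isPushout
        ; S-isPushout = S-po }
        where
          c-mono : Mono C c
          c-mono = mono-pushout x′-mono S-po
          module Q = FPC (hasFPCs c v c-mono v-mono)
          Q-monos : Mono C Q.d × Mono C Q.b
          Q-monos = stable c-mono v-mono Q.isFPC
          module TP = Pushout (pushout ι Q.b ι-mono)
          a-mono : Mono C TP.q₁
          a-mono = mono-pushoutˡ (proj₂ Q-monos) TP.isPushout

  -- Isomorphisms of frames and of the matches fitting them

  record FrameIso {p E E′} (F F′ : Frame p E E′) : Set (ℓ ⊔ e) where
    private
      module F  = Frame F
      module F′ = Frame F′
    field
      isoT : Iso C F.T F′.T
      isoS : Iso C F.S F′.S
      isoQ : Iso C F.Q F′.Q
      -- Compatibility with `k` follows from `i-commute` and `t-commute`, because `F′.t` is monic.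
      i-commute  : Iso.to isoT ∘ F.i ≈ F′.i
      j-commute  : Iso.to isoT ∘ F.j ≈ F′.j
      i′-commute : Iso.to isoS ∘ F.i′ ≈ F′.i′
      j′-commute : Iso.to isoS ∘ F.j′ ≈ F′.j′
      t-commute  : Iso.to isoT ∘ F.t ≈ F′.t ∘ Iso.to isoQ
      s-commute  : Iso.to isoS ∘ F.s ≈ F′.s ∘ Iso.to isoQ

  flipFrameIso : ∀ {p E E′} {F F′ : Frame p E E′} → FrameIso F F′ → FrameIso (flipFrame F) (flipFrame F′)
  flipFrameIso θ = record
    { isoT = isoS ; isoS = isoT ; isoQ = isoQ
    ; i-commute = i′-commute ; j-commute = j′-commute
    ; i′-commute = i-commute ; j′-commute = j-commute
    ; t-commute = s-commute ; s-commute = t-commute }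
    where open FrameIso θ

  record BaseIso {p E} (B B′ : Base p E) : Set (ℓ ⊔ e) where
    private
      module B  = Base B
      module B′ = Base B′
    field
      isoN : Iso C B.N B′.N
      isoK̄ : Iso C B.K̄ B′.K̄
      isoP : Iso C B.P B′.P
      nI-commute : Iso.to isoN ∘ B.nI ≈ B′.nI
      nE-commute : Iso.to isoN ∘ B.nE ≈ B′.nE
      ι-commute  : Iso.to isoN ∘ B.ι ≈ B′.ι ∘ Iso.to isoK̄
      u-commute  : Iso.to isoP ∘ B.u ≈ B′.u
      v-commute  : Iso.to isoP ∘ B.v ≈ B′.v ∘ Iso.to isoK̄

  module _ {p E E′} {F F′ : Frame p E E′} {H H′ : Half p E E′} (fits : Fits F H) (fits′ : Fits F′ H′) where
    private
      module p  = LinearRule p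
      module F  = Frame F
      module F′ = Frame F′
      module H  = Half H
      module H′ = Half H′
      module X  = Fits fits
      module X′ = Fits fits′

    -- The comparison retraces `frameOf`: `S` as a pushout of the second match, then `Q` by
    -- `v-isFPC`, then `T` as a pushout of `N` and `Q`.
    frameIso : (θ : BaseIso H.base H′.base) (μ : Iso C H.M′ H′.M′) →
      H.x′ ≈ H′.x′ ∘ Iso.to μ → Iso.to (BaseIso.isoP θ) ∘ H.y′ ≈ H′.y′ ∘ Iso.to μ → FrameIso F F′
    frameIso θ μ r w = record
      { isoT = isoT ; isoS = isoS ; isoQ = isoQ
      ; i-commute = along X.a∘nI X′.a∘nI nI-commute
      ; j-commute = along X.a∘nE X′.a∘nE nE-commute
      ; i′-commute = trans (∘-resp-≈ʳ (sym X.c∘u)) (trans (extend σc) (trans (∘-resp-≈ʳ u-commute) X′.c∘u))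
      ; j′-commute = trans (proj₁ (proj₂ mapS)) identityʳ
      ; t-commute = proj₂ (proj₂ mapT) ; s-commute = proj₁ (proj₂ mapQ) }
      where
        open BaseIso θ
        mapS = pushout-map X.S-isPushout X′.S-isPushout μ (iso-refl C) isoP (trans identityˡ r) w
        isoS : Iso C F.S F′.S
        isoS = proj₁ mapS
        σc : Iso.to isoS ∘ X.c ≈ X′.c ∘ Iso.to isoP
        σc = proj₂ (proj₂ mapS)
        mapQ = fpc-map F.s-mono F′.s-mono X.v-isFPC X′.v-isFPC isoK̄ isoP isoS v-commute σc
        isoQ : Iso C F.Q F′.Q
        isoQ = proj₁ mapQ
        mapT = pushout-map X.T-isPushout X′.T-isPushout isoK̄ isoN isoQ ι-commute (proj₂ (proj₂ mapQ))
        isoT : Iso C F.T F′.T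
        isoT = proj₁ mapT
        along : ∀ {Z} {n : Z ⇒ H.N} {n′ : Z ⇒ H′.N} {f : Z ⇒ F.T} {f′ : Z ⇒ F′.T} →
                X.a ∘ n ≈ f → X′.a ∘ n′ ≈ f′ → Iso.to isoN ∘ n ≈ n′ → Iso.to isoT ∘ f ≈ f′
        along an an′ nn = trans (∘-resp-≈ʳ (sym an)) (trans (extend (proj₁ (proj₂ mapT))) (trans (∘-resp-≈ʳ nn) an′))

    module _ (θ : FrameIso F F′) where
      open FrameIso θ

      -- The first match is the intersection of `i` and `j` in `T`, and isomorphisms of frames
      -- preserve it.
      matchIso : Σ[ μ ∈ Iso C H.M H′.M ] (H.x ≈ H′.x ∘ Iso.to μ × H.y ≈ H′.y ∘ Iso.to μ)
      matchIso =
        let μ , r , w = pullback-map X.x-isPullback X′.x-isPullback (iso-refl C) (iso-refl C) isoT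
                          (trans i-commute (sym identityʳ)) (trans j-commute (sym identityʳ))
        in μ , trans (sym identityˡ) r , trans (sym identityˡ) w

      matchIso′ : (η : BaseIso H.base H′.base) →
        Σ[ μ ∈ Iso C H.M′ H′.M′ ] (H.x′ ≈ H′.x′ ∘ Iso.to μ × Iso.to (BaseIso.isoP η) ∘ H.y′ ≈ H′.y′ ∘ Iso.to μ)
      matchIso′ η =
        let μ , r , w = pullback-map (pushout-isPullback H.x′-mono X.S-isPushout)
                          (pushout-isPullback H′.x′-mono X′.S-isPushout)
                          (iso-refl C) isoP isoS (trans j′-commute (sym identityʳ)) σc
        in μ , trans (sym identityˡ) r , w
        where
          open BaseIso η
          τa : Iso.to isoT ∘ X.a ≈ X′.a ∘ Iso.to isoN
          τa = pushout-unique H.N-isPushout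
            (trans assoc (trans (∘-resp-≈ʳ X.a∘nI) (trans i-commute
              (sym (trans assoc (trans (∘-resp-≈ʳ nI-commute) X′.a∘nI))))))
            (trans assoc (trans (∘-resp-≈ʳ X.a∘nE) (trans j-commute
              (sym (trans assoc (trans (∘-resp-≈ʳ nE-commute) X′.a∘nE))))))
          κq : Iso.to isoQ ∘ X.q ≈ X′.q ∘ Iso.to isoK̄
          κq = F′.t-mono _ _ (begin
            F′.t ∘ (Iso.to isoQ ∘ X.q)    ≈⟨ extend (sym t-commute) ⟩
            Iso.to isoT ∘ (F.t ∘ X.q)     ≈⟨ ∘-resp-≈ʳ (IsPullback.commute X.K̄-isPullback) ⟨
            Iso.to isoT ∘ (X.a ∘ H.ι)     ≈⟨ extend τa ⟩
            X′.a ∘ (Iso.to isoN ∘ H.ι)    ≈⟨ ∘-resp-≈ʳ ι-commute ⟩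
            X′.a ∘ (H′.ι ∘ Iso.to isoK̄)   ≈⟨ extend (IsPullback.commute X′.K̄-isPullback) ⟩
            F′.t ∘ (X′.q ∘ Iso.to isoK̄)   ∎)
          σc : Iso.to isoS ∘ X.c ≈ X′.c ∘ Iso.to isoP
          σc = pushout-unique H.P-isPushout
            (trans assoc (trans (∘-resp-≈ʳ X.c∘u) (trans i′-commute
              (sym (trans assoc (trans (∘-resp-≈ʳ u-commute) X′.c∘u))))))
            (begin
              (Iso.to isoS ∘ X.c) ∘ H.v              ≈⟨ assoc ⟩
              Iso.to isoS ∘ (X.c ∘ H.v)              ≈⟨ ∘-resp-≈ʳ X.c∘v ⟩
              Iso.to isoS ∘ (F.s ∘ X.q)              ≈⟨ extend s-commute ⟩
              F′.s ∘ (Iso.to isoQ ∘ X.q)             ≈⟨ ∘-resp-≈ʳ κq ⟩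
              F′.s ∘ (X′.q ∘ Iso.to isoK̄)            ≈⟨ extend X′.c∘v ⟨
              X′.c ∘ (H′.v ∘ Iso.to isoK̄)            ≈⟨ ∘-resp-≈ʳ v-commute ⟨
              X′.c ∘ (Iso.to isoP ∘ H.v)             ≈⟨ assoc ⟨
              (X′.c ∘ Iso.to isoP) ∘ H.v             ∎)

-- The two iterated compositions

module Associativity {o ℓ e : Level} (C : Category o ℓ e) (adhesive : Adhesive C)
    (hasFPCs : HasFPCsAlongMonos C) (stable : MonosStableUnderFPCs C)
    (p₁ p₂ p₃ : LinearRule C) where
  open Category C
  open Equiv
  open HomReasoning
  open Adhesive adhesive
  open SqPO C adhesive hasFPCs stable
  open CategoryLemmas C
  open AdhesiveLemmas C adhesive hasFPCs stable
  open Diagrams C adhesive hasFPCs stable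
  private
    module p₁ = LinearRule p₁
    module p₂ = LinearRule p₂
    module p₃ = LinearRule p₃
    module LeftPairs  = Setoid (MatchPairs₃₍₂₁₎ p₃ p₂ p₁)
    module RightPairs = Setoid (MatchPairs₍₃₂₎₁ p₃ p₂ p₁)

  -- The two pushouts carry admissibility. They are kept apart from the frame because they break its
  -- symmetry: nothing comparable holds on the input side of `p₂`.
  record Middle : Set (o ⊔ ℓ ⊔ e) where
    field
      frame : Frame p₂ p₁.O p₃.I
    open Frame frame public
    field
      {R}         : Obj
      r           : p₁.K ⇒ R
      ρ           : R ⇒ T
      S-isPushout : IsPushout C p₂.outₗ k i′ s
      T-isPushout : IsPushout C p₁.outₗ r j ρ

  leftBase : Match p₂ p₁ → Base p₂ p₁.O
  leftBase m = record
    { x-mono = m₂-mono ; y-mono = m₁-mono ; N-isPushout = N-isPushout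
    ; K̄-isFPC = K̄₂-isFPC ; P-isPushout = O₂₁-isPushout }
    where open Composition p₂ p₁ m

  rightBase : Match p₃ p₂ → Base (flip p₂) p₃.I
  rightBase m = record
    { x-mono = m₁-mono ; y-mono = m₂-mono ; N-isPushout = pushout-swap C N-isPushout
    ; K̄-isFPC = pushout-fpc p₂.out-mono K̄₁-isPushout ; P-isPushout = I₂₁-isPushout }
    where open Composition p₃ p₂ m

  leftHalf : LeftPairs.Carrier → Half p₂ p₁.O p₃.I
  leftHalf (m , n) = record { base = leftBase m ; x′-mono = m₂-mono ; y′-mono = m₁-mono }
    where open Match n

  rightHalf : RightPairs.Carrier → Half (flip p₂) p₃.I p₁.O
  rightHalf (m , n) = record { base = rightBase m ; x′-mono = m₁-mono ; y′-mono = m₂-mono }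
    where open Match n

  LeftFits : Frame p₂ p₁.O p₃.I → LeftPairs.Carrier → Set (o ⊔ ℓ ⊔ e)
  LeftFits F μ = Fits F (leftHalf μ)

  RightFits : Frame p₂ p₁.O p₃.I → RightPairs.Carrier → Set (o ⊔ ℓ ⊔ e)
  RightFits F ν = Fits (flipFrame F) (rightHalf ν)

  -- From matches to middle objects

  module LeftComplement {F : Frame p₂ p₁.O p₃.I} {μ : LeftPairs.Carrier} (fits : LeftFits F μ) where
    open Frame F
    open Fits fits
    private
      module M = Composition p₂ p₁ (proj₁ μ)
      module H = Half (leftHalf μ)
      module N = Composition p₃ (compose p₂ p₁ (proj₁ μ)) (proj₂ μ)

    isoS : Σ[ φ ∈ Iso C N.N S ] (Iso.to φ ∘ N.n₂ ≈ j′ ∘ id × Iso.to φ ∘ N.n₁ ≈ c ∘ id)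
    isoS = pushout-map N.N-isPushout S-isPushout (iso-refl C) (iso-refl C) (iso-refl C)
             (square-refl C) (square-refl C)

    ζ : N.K̄₁ ⇒ S
    ζ = Iso.to (proj₁ isoS) ∘ N.o₁′

    Z-isPushout : IsPushout C (M.o₂′ ∘ M.i₂″) N.k₁ c ζ
    Z-isPushout = pushout-iso N.K̄₁-isPushout (proj₁ isoS) (trans (proj₂ (proj₂ isoS)) identityʳ) refl

    out-mono′ : Mono C (M.o₂′ ∘ M.i₂″)
    out-mono′ = LinearRule.out-mono M.composite

    -- The complement meets `O₂₁` only in `K₂₁`, which lies in `K̄₂`; finality of `Q` over `O₂₁`
    -- therefore absorbs it.
    z-lift : ζ ⊑ s
    z-lift = fpc-⊑ v-isFPC ζ λ g h p →
      let w , q = pullback-⊑₁ (pushout-isPullback out-mono′ Z-isPushout) (sym p) in _ , trans (sym assoc) q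

    z : N.K̄₁ ⇒ Q
    z = proj₁ z-lift

    -- The decomposition of `S` into `O₂₁` and the complement, restricted to `Q`: the first piece
    -- becomes `K̄₂`, and the second already lies in `Q`.
    Q-isPushout : IsPushout C M.i₂″ N.k₁ q z
    Q-isPushout = pushout-stable out-mono′ Z-isPushout
      (s-mono _ _ (begin
        s ∘ (q ∘ M.i₂″)         ≈⟨ extend c∘v ⟨
        c ∘ (M.o₂′ ∘ M.i₂″)     ≈⟨ IsPushout.commute Z-isPushout ⟩
        ζ ∘ N.k₁                ≈⟨ cancel C (proj₂ z-lift) ⟨
        s ∘ (z ∘ N.k₁)          ∎))
      (square-refl C) (pullback-mono H.v-mono)
      (pullback-swap C (IsFPC.isPullback v-isFPC))
      (pullback-resp refl refl refl (proj₂ z-lift) (pullback-mono s-mono))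

    v-isPushout : IsPushout C M.o₂′ q c s
    v-isPushout = pushout-swap C (pushout-cancel (pushout-swap C Q-isPushout) (sym c∘v)
      (pushout-resp refl refl (sym (proj₂ z-lift)) refl (pushout-swap C Z-isPushout)))

    S-isPushout′ : IsPushout C p₂.outₗ k i′ s
    S-isPushout′ = pushout-resp refl q∘κ c∘u refl (pushout-paste H.P-isPushout v-isPushout)

    o₁″-mono : Mono C M.o₁″
    o₁″-mono = mono-pullback C M.K₂₁-isPullback H.ι-mono

    -- The complement of `O₁` in `T` is assembled from the complements supplied by the two matches,
    -- `M.K̄₁` inside `N₂₁` and `N.K̄₁` inside `Q`, which overlap in `K₂₁`.
    module R = Pushout (pushout M.o₁″ N.k₁ o₁″-mono)

    abstract
      ρ-desc : Σ[ ρ ∈ R.Q ⇒ T ] (ρ ∘ R.q₁ ≈ a ∘ M.o₁′ × ρ ∘ R.q₂ ≈ t ∘ z)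
      ρ-desc = pushout-desc R.isPushout (begin
        (a ∘ M.o₁′) ∘ M.o₁″    ≈⟨ assoc ⟩
        a ∘ (M.o₁′ ∘ M.o₁″)    ≈⟨ ∘-resp-≈ʳ (IsPullback.commute M.K₂₁-isPullback) ⟨
        a ∘ (M.i₂′ ∘ M.i₂″)    ≈⟨ extend (IsPullback.commute K̄-isPullback) ⟩
        t ∘ (q ∘ M.i₂″)        ≈⟨ ∘-resp-≈ʳ (IsPushout.commute Q-isPushout) ⟩
        t ∘ (z ∘ N.k₁)         ≈⟨ assoc ⟨
        (t ∘ z) ∘ N.k₁         ∎)

    ρ : R.Q ⇒ T
    ρ = proj₁ ρ-desc

    ρ∘q₁ : ρ ∘ R.q₁ ≈ a ∘ M.o₁′
    ρ∘q₁ = proj₁ (proj₂ ρ-desc)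

    ρ∘q₂ : ρ ∘ R.q₂ ≈ t ∘ z
    ρ∘q₂ = proj₂ (proj₂ ρ-desc)

    ρ-isPushout : IsPushout C M.o₁′ R.q₁ a ρ
    ρ-isPushout = pushout-swap C (pushout-cancel (pushout-swap C R.isPushout) ρ∘q₁
      (pushout-resp refl (IsPullback.commute M.K₂₁-isPullback) (sym ρ∘q₂) refl
        (pushout-paste (pushout-swap C Q-isPushout) (pushout-swap C T-isPushout))))

    T-isPushout′ : IsPushout C p₁.outₗ (R.q₁ ∘ M.k₁) j ρ
    T-isPushout′ = pushout-resp refl refl a∘nE refl (pushout-paste M.K̄₁-isPushout ρ-isPushout)

    -- `Q-isPushout` is the restriction of `ρ-isPushout` along `t`, so van Kampen gives the
    -- remaining front face. Thus the second complement is `Q ∩ R`, which `ToLeft` uses in the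
    -- opposite direction.
    Z-isPullback : IsPullback C z R.q₂ t ρ
    Z-isPullback = pushout-front (mono-pushout p₁.out-mono M.K̄₁-isPushout) ρ-isPushout
      (sym (IsPullback.commute K̄-isPullback)) (sym ρ∘q₂) M.K₂₁-isPullback
      (pullback-swap C (pushout-isPullback o₁″-mono R.isPushout)) Q-isPushout

  abstract
    leftMiddle : ∀ μ → Σ[ D ∈ Middle ] LeftFits (Middle.frame D) μ
    leftMiddle μ = record
      { S-isPushout = LeftComplement.S-isPushout′ {μ = μ} (proj₂ framed)
      ; T-isPushout = LeftComplement.T-isPushout′ {μ = μ} (proj₂ framed) } , proj₂ framed
      where
        module N = Composition p₃ (compose p₂ p₁ (proj₁ μ)) (proj₂ μ)
        framed : Σ[ F ∈ Frame p₂ p₁.O p₃.I ] LeftFits F μ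
        framed = frameOf (leftHalf μ) N.n₂ N.n₁ N.N-isPushout

  module RightComplement {F : Frame p₂ p₁.O p₃.I} {ν : RightPairs.Carrier} (fits : RightFits F ν) where
    open Frame F
    open Fits fits
    private
      module M = Composition p₃ p₂ (proj₁ ν)
      module H = Half (rightHalf ν)
      module N = Composition (compose p₃ p₂ (proj₁ ν)) p₁ (proj₂ ν)

    isoT : Σ[ φ ∈ Iso C N.N T ] (Iso.to φ ∘ N.n₂ ≈ c ∘ id × Iso.to φ ∘ N.n₁ ≈ j ∘ id)
    isoT = pushout-map N.N-isPushout (pushout-swap C S-isPushout) (iso-refl C) (iso-refl C) (iso-refl C)
             (square-refl C) (square-refl C)

    ρ : N.K̄₁ ⇒ T
    ρ = Iso.to (proj₁ isoT) ∘ N.o₁′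

    T-isPushout′ : IsPushout C p₁.outₗ N.k₁ j ρ
    T-isPushout′ = pushout-iso N.K̄₁-isPushout (proj₁ isoT) (trans (proj₂ (proj₂ isoT)) identityʳ) refl

    S-isPushout′ : IsPushout C p₂.outₗ k i′ s
    S-isPushout′ = pushout-resp refl q∘κ a∘nI refl (pushout-paste M.K̄₁-isPushout T-isPushout)

  abstract
    rightMiddle : ∀ ν → Σ[ D ∈ Middle ] RightFits (Middle.frame D) ν
    rightMiddle ν = record
      { S-isPushout = RightComplement.S-isPushout′ {ν = ν} (proj₂ framed)
      ; T-isPushout = RightComplement.T-isPushout′ {ν = ν} (proj₂ framed) } , proj₂ framed
      where
        module N = Composition (compose p₃ p₂ (proj₁ ν)) p₁ (proj₂ ν)
        framed : Σ[ F ∈ Frame (flip p₂) p₃.I p₁.O ] Fits F (rightHalf ν)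
        framed = frameOf (rightHalf ν) N.n₁ N.n₂ (pushout-swap C N.N-isPushout)

  -- From middle objects to matches

  module ToRight (D : Middle) {μ : LeftPairs.Carrier} (fits : LeftFits (Middle.frame D) μ) where
    open Middle D
    private
      module M = Pullback (pullback j′ i′)
      M₂-mono : Mono C M.p₁
      M₂-mono = mono-pullbackʳ M.isPullback i′-mono
      M₁-mono : Mono C M.p₂
      M₁-mono = mono-pullback C M.isPullback j′-mono
      module N = Pushout (pushout M.p₁ M.p₂ M₂-mono)
      b-desc = pushout-desc N.isPushout (IsPullback.commute M.isPullback)
      b = proj₁ b-desc
      b-mono : Mono C b
      b-mono = union-mono j′-mono i′-mono M.isPullback N.isPushout (proj₁ (proj₂ b-desc)) (proj₂ (proj₂ b-desc))
      module K̄ = Pullback (pullback b s)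
      restricted = pushout-restrict p₂.out-mono b-mono S-isPushout (proj₂ (proj₂ b-desc)) K̄.isPullback

    match : Match p₃ p₂
    match = record
      { m₂ = M.p₁ ; m₁ = M.p₂ ; m₂-mono = M₂-mono ; m₁-mono = M₁-mono
      ; complement = record { isPushout = proj₁ (proj₂ restricted) } }

    embedding : Embedding (flipFrame frame) (rightBase match)
    embedding = embed (flipFrame frame) (rightBase match) (pullback-swap C M.isPullback)

    private
      c = Embedding.c embedding
      module M′ = Pullback (pullback j c)
      M₁′-mono : Mono C M′.p₁
      M₁′-mono = mono-pullbackʳ M′.isPullback (Embedding.c-mono embedding)
      M₂′-mono : Mono C M′.p₂
      M₂′-mono = mono-pullback C M′.isPullback j-mono
      fits° = opposite-fits fits embedding M₁′-mono M₂′-mono M′.isPullback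
      module N′ = Pushout (pushout M′.p₂ M′.p₁ M₂′-mono)
      -- By `opposite-fits`, `T` is a pushout of the second match, so the complement `R` in `T` can
      -- be carried over to the chosen pushout `N′`.
      isoN′ = pushout-map (pushout-swap C (Fits.S-isPushout fits°)) N′.isPushout
                (iso-refl C) (iso-refl C) (iso-refl C) (square-refl C) (square-refl C)

    match′ : Match (compose p₃ p₂ match) p₁
    match′ = record
      { m₂ = M′.p₂ ; m₁ = M′.p₁ ; m₂-mono = M₂′-mono ; m₁-mono = M₁′-mono
      ; complement = record
          { isPushout = pushout-iso T-isPushout (proj₁ isoN′) (trans (proj₂ (proj₂ isoN′)) identityʳ) refl } }

    rightFits : RightFits frame (match , match′)
    rightFits = fits°

  module ToLeft (D : Middle) {ν : RightPairs.Carrier} (fits : RightFits (Middle.frame D) ν) where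
    open Middle D
    private
      module M = Pullback (pullback i j)
      M₂-mono : Mono C M.p₁
      M₂-mono = mono-pullbackʳ M.isPullback j-mono
      M₁-mono : Mono C M.p₂
      M₁-mono = mono-pullback C M.isPullback i-mono
      module N = Pushout (pushout M.p₁ M.p₂ M₂-mono)
      b-desc = pushout-desc N.isPushout (IsPullback.commute M.isPullback)
      b = proj₁ b-desc
      b-mono : Mono C b
      b-mono = union-mono i-mono j-mono M.isPullback N.isPushout (proj₁ (proj₂ b-desc)) (proj₂ (proj₂ b-desc))
      module K̄ = Pullback (pullback b ρ)
      restricted = pushout-restrict p₁.out-mono b-mono T-isPushout (proj₂ (proj₂ b-desc)) K̄.isPullback

    match : Match p₂ p₁
    match = record
      { m₂ = M.p₁ ; m₁ = M.p₂ ; m₂-mono = M₂-mono ; m₁-mono = M₁-mono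
      ; complement = record { isPushout = proj₁ (proj₂ restricted) } }

    embedding : Embedding frame (leftBase match)
    embedding = embed frame (leftBase match) M.isPullback

    private
      module B = Base (leftBase match)
      module L = Composition p₂ p₁ match
      open Embedding embedding
      module M′ = Pullback (pullback j′ c)
      M₂′-mono : Mono C M′.p₁
      M₂′-mono = mono-pullbackʳ M′.isPullback c-mono
      M₁′-mono : Mono C M′.p₂
      M₁′-mono = mono-pullback C M′.isPullback j′-mono
      fits° = opposite-fits fits embedding M₂′-mono M₁′-mono M′.isPullback
      module N′ = Pushout (pushout M′.p₁ M′.p₂ M₂′-mono)
      isoN′ = pushout-map (Fits.S-isPushout fits°) N′.isPushout
                (iso-refl C) (iso-refl C) (iso-refl C) (square-refl C) (square-refl C)

      ρ-isPushout : IsPushout C L.o₁′ K̄.p₂ b ρ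
      ρ-isPushout = pushout-cancel L.K̄₁-isPushout (IsPullback.commute K̄.isPullback)
        (pushout-resp refl (sym (proj₂ (proj₂ restricted))) (sym (proj₂ (proj₂ b-desc))) refl T-isPushout)

      -- `embedding` presupposes `match`, whose complement was built with `b`; hence the inclusion
      -- of `N` into `T` arises twice.
      a≈b : a ≈ b
      a≈b = pushout-unique N.isPushout (trans a∘nI (sym (proj₁ (proj₂ b-desc))))
                                       (trans a∘nE (sym (proj₂ (proj₂ b-desc))))

      -- The witness for the second complement is `Q ∩ R`. Pulling `ρ-isPushout` back along `t`
      -- splits `Q` into `K̄₂` and `Z`, and pasting with `v-isPushout` makes `Z` a complement of
      -- `O₂₁` in `S`.
      module Z = Pullback (pullback t ρ)
      z-lift = pullback-lift Z.isPullback {h₁ = q ∘ L.i₂″} {h₂ = K̄.p₂ ∘ L.o₁″} (begin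
        t ∘ (q ∘ L.i₂″)         ≈⟨ extend (IsPullback.commute K̄-isPullback) ⟨
        a ∘ (L.i₂′ ∘ L.i₂″)     ≈⟨ ∘-resp-≈ a≈b (IsPullback.commute L.K₂₁-isPullback) ⟩
        b ∘ (L.o₁′ ∘ L.o₁″)     ≈⟨ extend (IsPullback.commute K̄.isPullback) ⟩
        ρ ∘ (K̄.p₂ ∘ L.o₁″)      ∎)

      Q-isPushout : IsPushout C L.i₂″ (proj₁ z-lift) q Z.p₁
      Q-isPushout = pushout-stable (mono-pushout p₁.out-mono L.K̄₁-isPushout) ρ-isPushout
        (sym (proj₁ (proj₂ z-lift))) (proj₂ (proj₂ z-lift)) L.K₂₁-isPullback
        (pullback-resp refl refl refl a≈b (pullback-swap C K̄-isPullback)) Z.isPullback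

      v-isPushout : IsPushout C B.v q c s
      v-isPushout = pushout-cancel B.P-isPushout c∘v (pushout-resp refl (sym q∘κ) (sym c∘u) refl S-isPushout)

      Z-isPushout : IsPushout C (L.o₂′ ∘ L.i₂″) (proj₁ z-lift) c (s ∘ Z.p₁)
      Z-isPushout = pushout-swap C (pushout-paste (pushout-swap C Q-isPushout) (pushout-swap C v-isPushout))

    match′ : Match p₃ (compose p₂ p₁ match)
    match′ = record
      { m₂ = M′.p₁ ; m₁ = M′.p₂ ; m₂-mono = M₂′-mono ; m₁-mono = M₁′-mono
      ; complement = record
          { isPushout = pushout-iso Z-isPushout (proj₁ isoN′) (trans (proj₂ (proj₂ isoN′)) identityʳ) refl } }

    leftFits : LeftFits frame (match , match′)
    leftFits = fits°

  -- Equality of matches is isomorphism of middle objects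

  compositionIso : ∀ {p q} {m m′ : Match p q} → m ≈ᴹ m′ → CompositionIso m m′
  compositionIso {p} {q} {m} {m′} θ = record
    { isoM = isoM ; isoN = isoN ; isoK̄₂ = isoK̄₂ ; isoK̄₁ = isoK̄₁
    ; isoO = proj₁ mapO ; isoK = proj₁ mapK ; isoI = proj₁ mapI
    ; m₂-commute  = trans (sym m₂-commute) identityˡ
    ; m₁-commute  = trans (sym m₁-commute) identityˡ
    ; n₂-commute  = trans (proj₁ (proj₂ mapN)) identityʳ
    ; n₁-commute  = trans (proj₂ (proj₂ mapN)) identityʳ
    ; k₂-commute  = trans (proj₂ (proj₂ mapK̄₂)) identityʳ
    ; k₁-commute  = trans (proj₂ (proj₂ mapK̄₁)) identityʳ
    ; i₂′-commute = proj₁ (proj₂ mapK̄₂)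
    ; o₁′-commute = proj₁ (proj₂ mapK̄₁)
    ; o₂₁-commute = trans (proj₁ (proj₂ mapO)) identityʳ
    ; o₂′-commute = proj₂ (proj₂ mapO)
    ; i₂₁-commute = trans (proj₁ (proj₂ mapI)) identityʳ
    ; i₁′-commute = proj₂ (proj₂ mapI)
    ; i₂″-commute = proj₁ (proj₂ mapK)
    ; o₁″-commute = proj₂ (proj₂ mapK) }
    where
      open MatchIso θ
      module p  = LinearRule p
      module q  = LinearRule q
      module D  = Composition p q m
      module D′ = Composition p q m′
      mapN = pushout-map D.N-isPushout D′.N-isPushout isoM (iso-refl C) (iso-refl C) m₂-commute m₁-commute
      isoN : Iso C D.N D′.N
      isoN = proj₁ mapN
      mapK̄₂ = fpc-map (proj₁ (stable D.n₂-mono p.in-mono D.K̄₂-isFPC)) (proj₁ (stable D′.n₂-mono p.in-mono D′.K̄₂-isFPC))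
                D.K̄₂-isFPC D′.K̄₂-isFPC (iso-refl C) (iso-refl C) isoN (square-refl C) (proj₁ (proj₂ mapN))
      isoK̄₂ : Iso C D.K̄₂ D′.K̄₂
      isoK̄₂ = proj₁ mapK̄₂
      -- The two complements are independent data of `m` and `m′`. Both are FPCs of isomorphic
      -- pairs, and so they agree.
      mapK̄₁ = fpc-map (mono-pushout q.out-mono D.K̄₁-isPushout) (mono-pushout q.out-mono D′.K̄₁-isPushout)
                (pushout-fpc q.out-mono D.K̄₁-isPushout) (pushout-fpc q.out-mono D′.K̄₁-isPushout)
                (iso-refl C) (iso-refl C) isoN (square-refl C) (proj₂ (proj₂ mapN))
      isoK̄₁ : Iso C D.K̄₁ D′.K̄₁
      isoK̄₁ = proj₁ mapK̄₁
      mapO = pushout-map D.O₂₁-isPushout D′.O₂₁-isPushout (iso-refl C) (iso-refl C) isoK̄₂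
               (square-refl C) (proj₂ (proj₂ mapK̄₂))
      mapI = pushout-map D.I₂₁-isPushout D′.I₂₁-isPushout (iso-refl C) (iso-refl C) isoK̄₁
               (square-refl C) (proj₂ (proj₂ mapK̄₁))
      mapK = pullback-map D.K₂₁-isPullback D′.K₂₁-isPullback isoK̄₂ isoK̄₁ isoN
               (proj₁ (proj₂ mapK̄₂)) (proj₁ (proj₂ mapK̄₁))

  leftBaseIso : ∀ {m m′ : Match p₂ p₁} → CompositionIso m m′ → BaseIso (leftBase m) (leftBase m′)
  leftBaseIso θ = record
    { isoN = isoN ; isoK̄ = isoK̄₂ ; isoP = isoO
    ; nI-commute = n₂-commute ; nE-commute = n₁-commute ; ι-commute = i₂′-commute
    ; u-commute = o₂₁-commute ; v-commute = o₂′-commute }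
    where open CompositionIso θ

  rightBaseIso : ∀ {m m′ : Match p₃ p₂} → CompositionIso m m′ → BaseIso (rightBase m) (rightBase m′)
  rightBaseIso θ = record
    { isoN = isoN ; isoK̄ = isoK̄₁ ; isoP = isoI
    ; nI-commute = n₁-commute ; nE-commute = n₂-commute ; ι-commute = o₁′-commute
    ; u-commute = i₂₁-commute ; v-commute = i₁′-commute }
    where open CompositionIso θ

  module _ {F F′ : Frame p₂ p₁.O p₃.I} where

    left⇒frame : ∀ {μ μ′} → LeftFits F μ → LeftFits F′ μ′ → μ LeftPairs.≈ μ′ → FrameIso F F′
    left⇒frame {μ} {μ′} fits fits′ (θ , η) =
      frameIso {F = F} {F′} {leftHalf μ} {leftHalf μ′} fits fits′ β isoM x-commute y-commute
      where
        isoM : Iso C (Match.M (proj₂ μ)) (Match.M (proj₂ μ′))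
        isoM = MatchIso.isoM η
        β : BaseIso (leftBase (proj₁ μ)) (leftBase (proj₁ μ′))
        β = leftBaseIso {proj₁ μ} {proj₁ μ′} θ
        x-commute : Match.m₂ (proj₂ μ) ≈ Match.m₂ (proj₂ μ′) ∘ Iso.to isoM
        x-commute = trans (sym identityˡ) (MatchIso.m₂-commute η)
        y-commute : Iso.to (CompositionIso.isoO θ) ∘ Match.m₁ (proj₂ μ) ≈ Match.m₁ (proj₂ μ′) ∘ Iso.to isoM
        y-commute = MatchIso.m₁-commute η

    frame⇒left : ∀ {μ μ′} → LeftFits F μ → LeftFits F′ μ′ → FrameIso F F′ → μ LeftPairs.≈ μ′
    frame⇒left {μ} {μ′} fits fits′ φ = θ , record
      { isoM = proj₁ second
      ; m₂-commute = trans identityˡ (proj₁ (proj₂ second)) ; m₁-commute = proj₂ (proj₂ second) }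
      where
        first = matchIso {F = F} {F′} {leftHalf μ} {leftHalf μ′} fits fits′ φ
        θ : CompositionIso (proj₁ μ) (proj₁ μ′)
        θ = compositionIso (record
          { isoM = proj₁ first
          ; m₂-commute = trans identityˡ (proj₁ (proj₂ first))
          ; m₁-commute = trans identityˡ (proj₂ (proj₂ first)) })
        second = matchIso′ {F = F} {F′} {leftHalf μ} {leftHalf μ′} fits fits′ φ (leftBaseIso {proj₁ μ} {proj₁ μ′} θ)

    right⇒frame : ∀ {ν ν′} → RightFits F ν → RightFits F′ ν′ → ν RightPairs.≈ ν′ → FrameIso F F′
    right⇒frame {ν} {ν′} fits fits′ (θ , η) =
      flipFrameIso {F = flipFrame F} {flipFrame F′} φ
      where
        isoM : Iso C (Match.M (proj₂ ν)) (Match.M (proj₂ ν′))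
        isoM = MatchIso.isoM η
        β : BaseIso (rightBase (proj₁ ν)) (rightBase (proj₁ ν′))
        β = rightBaseIso {proj₁ ν} {proj₁ ν′} θ
        x-commute : Match.m₁ (proj₂ ν) ≈ Match.m₁ (proj₂ ν′) ∘ Iso.to isoM
        x-commute = trans (sym identityˡ) (MatchIso.m₁-commute η)
        y-commute : Iso.to (CompositionIso.isoI θ) ∘ Match.m₂ (proj₂ ν) ≈ Match.m₂ (proj₂ ν′) ∘ Iso.to isoM
        y-commute = MatchIso.m₂-commute η
        φ : FrameIso (flipFrame F) (flipFrame F′)
        φ = frameIso {F = flipFrame F} {flipFrame F′} {rightHalf ν} {rightHalf ν′} fits fits′ β isoM x-commute y-commute

    frame⇒right : ∀ {ν ν′} → RightFits F ν → RightFits F′ ν′ → FrameIso F F′ → ν RightPairs.≈ ν′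
    frame⇒right {ν} {ν′} fits fits′ φ = θ , record
      { isoM = proj₁ second
      ; m₂-commute = proj₂ (proj₂ second) ; m₁-commute = trans identityˡ (proj₁ (proj₂ second)) }
      where
        φ° = flipFrameIso {F = F} {F′} φ
        first = matchIso {F = flipFrame F} {flipFrame F′} {rightHalf ν} {rightHalf ν′} fits fits′ φ°
        θ : CompositionIso (proj₁ ν) (proj₁ ν′)
        θ = compositionIso (record
          { isoM = proj₁ first
          ; m₂-commute = trans identityˡ (proj₂ (proj₂ first))
          ; m₁-commute = trans identityˡ (proj₁ (proj₂ first)) })
        second = matchIso′ {F = flipFrame F} {flipFrame F′} {rightHalf ν} {rightHalf ν′} fits fits′ φ° (rightBaseIso {proj₁ ν} {proj₁ ν′} θ)

  leftFrame : LeftPairs.Carrier → Frame p₂ p₁.O p₃.I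
  leftFrame μ = Middle.frame (proj₁ (leftMiddle μ))

  leftFrame-fits : ∀ μ → LeftFits (leftFrame μ) μ
  leftFrame-fits μ = proj₂ (leftMiddle μ)

  abstract
    rightMatches : (D : Middle) → ∀ {μ} → LeftFits (Middle.frame D) μ →
                   Σ[ ν ∈ RightPairs.Carrier ] RightFits (Middle.frame D) ν
    rightMatches D {μ} fits = (ToRight.match D {μ} fits , ToRight.match′ D {μ} fits) , ToRight.rightFits D {μ} fits

    leftMatches : (D : Middle) → ∀ {ν} → RightFits (Middle.frame D) ν →
                  Σ[ μ ∈ LeftPairs.Carrier ] LeftFits (Middle.frame D) μ
    leftMatches D {ν} fits = (ToLeft.match D {ν} fits , ToLeft.match′ D {ν} fits) , ToLeft.leftFits D {ν} fits

  toRight : LeftPairs.Carrier → RightPairs.Carrier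
  toRight μ = proj₁ (rightMatches (proj₁ (leftMiddle μ)) {μ} (leftFrame-fits μ))

  toRight-fits : ∀ μ → RightFits (leftFrame μ) (toRight μ)
  toRight-fits μ = proj₂ (rightMatches (proj₁ (leftMiddle μ)) {μ} (leftFrame-fits μ))

  toRight-cong : ∀ μ μ′ → μ LeftPairs.≈ μ′ → toRight μ RightPairs.≈ toRight μ′
  toRight-cong μ μ′ θ =
    frame⇒right {leftFrame μ} {leftFrame μ′} {toRight μ} {toRight μ′} (toRight-fits μ) (toRight-fits μ′)
      (left⇒frame {leftFrame μ} {leftFrame μ′} {μ} {μ′} (leftFrame-fits μ) (leftFrame-fits μ′) θ)

  toRight-injective : ∀ μ μ′ → toRight μ RightPairs.≈ toRight μ′ → μ LeftPairs.≈ μ′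
  toRight-injective μ μ′ θ =
    frame⇒left {leftFrame μ} {leftFrame μ′} {μ} {μ′} (leftFrame-fits μ) (leftFrame-fits μ′)
      (right⇒frame {leftFrame μ} {leftFrame μ′} {toRight μ} {toRight μ′} (toRight-fits μ) (toRight-fits μ′) θ)

  toLeft : RightPairs.Carrier → LeftPairs.Carrier
  toLeft ν = proj₁ (leftMatches (proj₁ (rightMiddle ν)) {ν} (proj₂ (rightMiddle ν)))

  rightFrame : RightPairs.Carrier → Frame p₂ p₁.O p₃.I
  rightFrame ν = Middle.frame (proj₁ (rightMiddle ν))

  rightFrame-fits : ∀ ν → RightFits (rightFrame ν) ν
  rightFrame-fits ν = proj₂ (rightMiddle ν)

  toLeft-fits : ∀ ν → LeftFits (rightFrame ν) (toLeft ν)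
  toLeft-fits ν = proj₂ (leftMatches (proj₁ (rightMiddle ν)) {ν} (proj₂ (rightMiddle ν)))

  toLeft-refl : ∀ ν → toLeft ν LeftPairs.≈ toLeft ν
  toLeft-refl ν = LeftPairs.refl {toLeft ν}

  -- `toLeft ν` fits both frames, so reflexivity of its equality already relates them.
  toLeft-frameIso : ∀ ν → FrameIso (leftFrame (toLeft ν)) (rightFrame ν)
  toLeft-frameIso ν = left⇒frame {leftFrame (toLeft ν)} {rightFrame ν} {toLeft ν} {toLeft ν}
    (leftFrame-fits (toLeft ν)) (toLeft-fits ν) (toLeft-refl ν)

  toRight-toLeft : ∀ ν → toRight (toLeft ν) RightPairs.≈ ν
  toRight-toLeft ν = frame⇒right {leftFrame (toLeft ν)} {rightFrame ν} {toRight (toLeft ν)} {ν}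
    (toRight-fits (toLeft ν)) (rightFrame-fits ν) (toLeft-frameIso ν)

  toRight-surjective : ∀ ν μ → μ LeftPairs.≈ toLeft ν → toRight μ RightPairs.≈ ν
  toRight-surjective ν μ η = RightPairs.trans {toRight μ} {toRight (toLeft ν)} {ν}
    (toRight-cong μ (toLeft ν) η) (toRight-toLeft ν)

  correspondence : Bijection (MatchPairs₃₍₂₁₎ p₃ p₂ p₁) (MatchPairs₍₃₂₎₁ p₃ p₂ p₁)
  correspondence = record
    { to   = toRight
    ; cong = λ {μ} {μ′} → toRight-cong μ μ′
    ; bijective = (λ {μ} {μ′} → toRight-injective μ μ′) ,
        λ ν → toLeft ν , λ {μ} → toRight-surjective ν μ }

  -- Both composites are determined by the middle object

  -- `K̄₃` lies over `S` and `R` over `T`; only `Q` maps to both, so the triple intersection is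
  -- formed in two pullbacks through `Q`. Each composite brings its own `R`, since complements of
  -- the same pair are isomorphic.
  record Presents (D : Middle) (c : LinearRule C) : Set (o ⊔ ℓ ⊔ e) where
    open Middle D using (T; S; Q; j; j′; t; s)
    private module c = LinearRule c
    field
      {K̄₃ R W}     : Obj
      d₃           : K̄₃ ⇒ S
      b₃           : p₃.K ⇒ K̄₃
      r            : p₁.K ⇒ R
      ρ            : R ⇒ T
      w₁           : W ⇒ K̄₃
      w₂           : W ⇒ Q
      o₃           : p₃.O ⇒ c.O
      o′           : K̄₃ ⇒ c.O
      i₁           : p₁.I ⇒ c.I
      i′           : R ⇒ c.I
      h            : c.K ⇒ W
      x            : c.K ⇒ R
      d₃-mono      : Mono C d₃
      K̄₃-isFPC     : IsFPC C j′ p₃.inₗ d₃ b₃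
      R-isPushout  : IsPushout C p₁.outₗ r j ρ
      W-isPullback : IsPullback C w₁ w₂ d₃ s
      O-isPushout  : IsPushout C p₃.outₗ b₃ o₃ o′
      I-isPushout  : IsPushout C p₁.inₗ r i₁ i′
      K-isPullback : IsPullback C h x (t ∘ w₂) ρ
      out-factor   : c.outₗ ≈ o′ ∘ (w₁ ∘ h)
      in-factor    : c.inₗ ≈ i′ ∘ x

  presents-unique : ∀ {D c c′} → Presents D c → Presents D c′ → _≅_ C c c′
  presents-unique {D} {c} {c′} P P′ = record
    { isoO = isoO ; isoK = isoK ; isoI = isoI
    ; out-commute = begin
        Iso.to isoO ∘ c.outₗ                         ≈⟨ ∘-resp-≈ʳ P.out-factor ⟩
        Iso.to isoO ∘ (P.o′ ∘ (P.w₁ ∘ P.h))          ≈⟨ extend (proj₂ (proj₂ mapO)) ⟩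
        P′.o′ ∘ (Iso.to isoK̄₃ ∘ (P.w₁ ∘ P.h))        ≈⟨ ∘-resp-≈ʳ (extend (proj₁ (proj₂ mapW))) ⟩
        P′.o′ ∘ (P′.w₁ ∘ (Iso.to isoW ∘ P.h))        ≈⟨ ∘-resp-≈ʳ (∘-resp-≈ʳ (proj₁ (proj₂ mapK))) ⟩
        P′.o′ ∘ (P′.w₁ ∘ (P′.h ∘ Iso.to isoK))       ≈⟨ trans (∘-resp-≈ʳ (sym assoc)) (sym assoc) ⟩
        (P′.o′ ∘ (P′.w₁ ∘ P′.h)) ∘ Iso.to isoK       ≈⟨ ∘-resp-≈ˡ P′.out-factor ⟨
        c′.outₗ ∘ Iso.to isoK                        ∎
    ; in-commute = begin
        Iso.to isoI ∘ c.inₗ               ≈⟨ ∘-resp-≈ʳ P.in-factor ⟩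
        Iso.to isoI ∘ (P.i′ ∘ P.x)        ≈⟨ extend (proj₂ (proj₂ mapI)) ⟩
        P′.i′ ∘ (Iso.to isoR ∘ P.x)       ≈⟨ ∘-resp-≈ʳ (proj₂ (proj₂ mapK)) ⟩
        P′.i′ ∘ (P′.x ∘ Iso.to isoK)      ≈⟨ assoc ⟨
        (P′.i′ ∘ P′.x) ∘ Iso.to isoK      ≈⟨ ∘-resp-≈ˡ P′.in-factor ⟨
        c′.inₗ ∘ Iso.to isoK              ∎ }
    where
      module c  = LinearRule c
      module c′ = LinearRule c′
      module P  = Presents P
      module P′ = Presents P′
      mapK̄₃ = fpc-map P.d₃-mono P′.d₃-mono P.K̄₃-isFPC P′.K̄₃-isFPC (iso-refl C) (iso-refl C) (iso-refl C)
                (square-refl C) (square-refl C)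
      isoK̄₃ : Iso C P.K̄₃ P′.K̄₃
      isoK̄₃ = proj₁ mapK̄₃
      mapR = fpc-map (mono-pushout p₁.out-mono P.R-isPushout) (mono-pushout p₁.out-mono P′.R-isPushout)
               (pushout-fpc p₁.out-mono P.R-isPushout) (pushout-fpc p₁.out-mono P′.R-isPushout)
               (iso-refl C) (iso-refl C) (iso-refl C) (square-refl C) (square-refl C)
      isoR : Iso C P.R P′.R
      isoR = proj₁ mapR
      mapO = pushout-map P.O-isPushout P′.O-isPushout (iso-refl C) (iso-refl C) isoK̄₃
               (square-refl C) (proj₂ (proj₂ mapK̄₃))
      isoO : Iso C c.O c′.O
      isoO = proj₁ mapO
      mapI = pushout-map P.I-isPushout P′.I-isPushout (iso-refl C) (iso-refl C) isoR
               (square-refl C) (proj₂ (proj₂ mapR))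
      isoI : Iso C c.I c′.I
      isoI = proj₁ mapI
      mapW = pullback-map P.W-isPullback P′.W-isPullback isoK̄₃ (iso-refl C) (iso-refl C)
               (proj₁ (proj₂ mapK̄₃)) (square-refl C)
      isoW : Iso C P.W P′.W
      isoW = proj₁ mapW
      mapK = pullback-map P.K-isPullback P′.K-isPullback isoW isoR (iso-refl C)
               (trans identityˡ (trans (∘-resp-≈ʳ (trans (sym identityˡ) (proj₂ (proj₂ mapW)))) (sym assoc)))
               (proj₁ (proj₂ mapR))
      isoK : Iso C c.K c′.K
      isoK = proj₁ mapK

  abstract
    left-presents : ∀ (D : Middle) μ → LeftFits (Middle.frame D) μ → Presents D (composite₃₍₂₁₎ p₃ p₂ p₁ μ)
    left-presents D μ fits = record
      { d₃ = d₃ ; b₃ = N.k₂ ; r = L.R.q₁ ∘ M.k₁ ; ρ = L.ρ ; w₁ = W.p₁ ; w₂ = W.p₂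
      ; o₃ = N.o₂₁ ; o′ = N.o₂′ ; i₁ = N.i₂₁ ∘ M.i₂₁ ; i′ = proj₁ glued ; h = h ; x = L.R.q₂ ∘ N.o₁″
      ; d₃-mono = mono-∘ C (iso-mono φ) i₂′-mono
      ; K̄₃-isFPC = fpc-iso p₃.in-mono i₂′-mono N.K̄₂-isFPC φ (trans (proj₁ (proj₂ L.isoS)) identityʳ)
      ; R-isPushout = L.T-isPushout′
      ; W-isPullback = W.isPullback
      ; O-isPushout = N.O₂₁-isPushout
      ; I-isPushout = proj₁ (proj₂ glued)
      -- The context of the composite is the intersection of `K̄₃` with `N.K̄₁` over `S`. As `N.K̄₁`
      -- lies in `Q`, this is its intersection with `W` over `Q`; then `N.K̄₁ = Q ∩ R` is pasted on.
      ; K-isPullback = pullback-paste L.Z-isPullback (pullback-swap C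
          (pullback-cancel (pullback-swap C W.isPullback) (sym h₂)
            (pullback-resp refl (sym h₁) (sym (proj₂ L.z-lift)) refl (pullback-swap C K-isPullback))))
      ; out-factor = ∘-resp-≈ʳ (sym h₁)
      ; in-factor = trans (∘-resp-≈ˡ (sym (proj₂ (proj₂ glued)))) assoc }
      where
        open Middle D
        module M = Composition p₂ p₁ (proj₁ μ)
        module N = Composition p₃ (compose p₂ p₁ (proj₁ μ)) (proj₂ μ)
        module L = LeftComplement {frame} {μ} fits
        φ : Iso C N.N S
        φ = proj₁ L.isoS
        i₂′-mono : Mono C N.i₂′
        i₂′-mono = proj₁ (stable N.n₂-mono p₃.in-mono N.K̄₂-isFPC)
        d₃ : N.K̄₂ ⇒ S
        d₃ = Iso.to φ ∘ N.i₂′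
        K-isPullback : IsPullback C N.i₂″ N.o₁″ d₃ L.ζ
        K-isPullback = pullback-postmono (iso-mono φ) N.K₂₁-isPullback
        module W = Pullback (pullback d₃ s)
        lift : Σ[ h ∈ N.K₂₁ ⇒ W.P ] (W.p₁ ∘ h ≈ N.i₂″ × W.p₂ ∘ h ≈ L.z ∘ N.o₁″)
        lift = pullback-lift W.isPullback (trans (IsPullback.commute K-isPullback)
                 (trans (∘-resp-≈ˡ (sym (proj₂ L.z-lift))) assoc))
        h : N.K₂₁ ⇒ W.P
        h = proj₁ lift
        h₁ : W.p₁ ∘ h ≈ N.i₂″
        h₁ = proj₁ (proj₂ lift)
        h₂ : W.p₂ ∘ h ≈ L.z ∘ N.o₁″
        h₂ = proj₂ (proj₂ lift)
        glued : Σ[ θ ∈ L.R.Q ⇒ N.I₂₁ ] (IsPushout C p₁.inₗ (L.R.q₁ ∘ M.k₁) (N.i₂₁ ∘ M.i₂₁) θ × θ ∘ L.R.q₂ ≈ N.i₁′)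
        glued = pushout-glue M.I₂₁-isPushout L.R.isPushout N.I₂₁-isPushout

  module RightPresents (D : Middle) (ν : RightPairs.Carrier) (fits : RightFits (Middle.frame D) ν) where
    open Middle D
    open Fits fits using (a; q; c; a-mono; a∘nE; c∘u; c∘v; K̄-isPullback; v-isFPC)
      renaming (T-isPushout to q-isPushout)
    private
      module M = Composition p₃ p₂ (proj₁ ν)
      module N = Composition (compose p₃ p₂ (proj₁ ν)) p₁ (proj₂ ν)
      module H = Half (rightHalf ν)
      module L = RightComplement {frame} {ν} fits

    φ : Iso C N.N T
    φ = proj₁ L.isoT

    in-mono′ : Mono C (M.i₁′ ∘ M.o₁″)
    in-mono′ = LinearRule.in-mono M.composite

    i₂′-mono : Mono C N.i₂′
    i₂′-mono = proj₁ (stable N.n₂-mono in-mono′ N.K̄₂-isFPC)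

    i₂′-mono₃ : Mono C M.i₂′
    i₂′-mono₃ = proj₁ (stable M.n₂-mono p₃.in-mono M.K̄₂-isFPC)

    ω : N.K̄₂ ⇒ T
    ω = Iso.to φ ∘ N.i₂′

    ω-mono : Mono C ω
    ω-mono = mono-∘ C (iso-mono φ) i₂′-mono

    ω-isFPC : IsFPC C c (M.i₁′ ∘ M.o₁″) ω N.k₂
    ω-isFPC = fpc-iso in-mono′ i₂′-mono N.K̄₂-isFPC φ (trans (proj₁ (proj₂ L.isoT)) identityʳ)

    -- The right composite contains only fragments of this object: `M.K̄₂` turns out to be its
    -- intersection with `N₃₂`, and `N.K̄₂` its intersection with `Q`.
    module K̄₃ = FPC (hasFPCs j′ p₃.inₗ j′-mono p₃.in-mono)

    d₃-mono : Mono C K̄₃.d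
    d₃-mono = proj₁ (stable j′-mono p₃.in-mono K̄₃.isFPC)

    e-lift : a ∘ M.i₂′ ⊑ K̄₃.d
    e-lift = fpc-⊑ K̄₃.isFPC (a ∘ M.i₂′) λ g h p → fpc-element M.K̄₂-isFPC
      (g , a-mono _ _ (trans (sym assoc) (trans p (sym (cancel C a∘nE)))))

    ε : M.K̄₂ ⇒ K̄₃.D
    ε = proj₁ e-lift

    ε-isPullback : IsPullback C M.i₂′ ε a K̄₃.d
    ε-isPullback = pullback-intro i₂′-mono₃ d₃-mono (sym (proj₂ e-lift))
      λ h₁ h₂ p → fpc-⊑ M.K̄₂-isFPC h₁ λ g h r → fpc-element K̄₃.isFPC
        (h₂ ∘ g , trans (extend (sym p)) (trans (∘-resp-≈ʳ r) (cancel C a∘nE)))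

    -- An element of `ω` in `I₂` lies in `I₃₂`, hence in `K₃₂` and so in `M.K̄₁`, which meets `I₂`
    -- only in `K₂`.
    ω⊑t : ω ⊑ t
    ω⊑t = fpc-⊑ t-isFPC ω λ g h p →
      let w , r = fpc-element ω-isFPC {h = H.u ∘ h} (g , trans p (sym (cancel C c∘u)))
      in pullback-⊑₁ (pushout-isPullback p₂.in-mono H.P-isPushout) (sym (trans (sym assoc) r))

    w₂ : N.K̄₂ ⇒ Q
    w₂ = proj₁ ω⊑t

    w₂-mono : Mono C w₂
    w₂-mono = mono-first (mono-resp (sym (proj₂ ω⊑t)) ω-mono)

    -- An element that also lies in `I₃` lies in both `N₃₂` and `Q`, hence in `M.K̄₁` and so in
    -- `I₃₂`. There `ω` leaves only `K₃₂`, which sits in `M.K̄₂`, and `M.K̄₂` meets `I₃` only in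
    -- `K₃`.
    s∘w₂⊑d₃ : s ∘ w₂ ⊑ K̄₃.d
    s∘w₂⊑d₃ = fpc-⊑ K̄₃.isFPC (s ∘ w₂) λ g h p →
      let π , π₁ , π₂ = pullback-lift K̄-isPullback {h₁ = M.n₂ ∘ h} {h₂ = w₂ ∘ g}
            (trans (cancel C a∘nE) (trans (sym p) assoc))
          κ , r = fpc-element ω-isFPC {h = M.i₁′ ∘ π} (g , (begin
            ω ∘ g               ≈⟨ cancel C (proj₂ ω⊑t) ⟨
            t ∘ (w₂ ∘ g)        ≈⟨ ∘-resp-≈ʳ π₂ ⟨
            t ∘ (q ∘ π)         ≈⟨ extend c∘v ⟨
            c ∘ (M.i₁′ ∘ π)     ∎))
          π≈ = H.v-mono _ _ (trans (sym assoc) r)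
      in fpc-element M.K̄₂-isFPC (M.i₂″ ∘ κ , (begin
            M.i₂′ ∘ (M.i₂″ ∘ κ)    ≈⟨ extend (IsPullback.commute M.K₂₁-isPullback) ⟩
            M.o₁′ ∘ (M.o₁″ ∘ κ)    ≈⟨ ∘-resp-≈ʳ π≈ ⟩
            M.o₁′ ∘ π              ≈⟨ π₁ ⟩
            M.n₂ ∘ h               ∎))

    w₁ : N.K̄₂ ⇒ K̄₃.D
    w₁ = proj₁ s∘w₂⊑d₃

    -- An element of `Q` in `I₃₂` lies in `M.K̄₁`, hence in `N₃₂`; being in `K̄₃` as well, it lies
    -- in `M.K̄₂`. The two meet in `K₃₂`.
    ω-element : ∀ {F G} {h₁ : F ⇒ K̄₃.D} {h₂ : F ⇒ Q} → K̄₃.d ∘ h₁ ≈ s ∘ h₂ →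
      (g : G ⇒ F) (h : G ⇒ M.I₂₁) → (t ∘ h₂) ∘ g ≈ c ∘ h → h ⊑ M.i₁′ ∘ M.o₁″
    ω-element {F} {G} {h₁} {h₂} p g h n = proj₁ κ , trans assoc (trans (∘-resp-≈ʳ (proj₂ κ)) (proj₁ (proj₂ π)))
      where
        π : Σ[ π ∈ G ⇒ M.K̄₁ ] (M.i₁′ ∘ π ≈ h × q ∘ π ≈ h₂ ∘ g)
        π = pullback-lift (IsFPC.isPullback v-isFPC) (trans (sym n) assoc)
        commutes : a ∘ (M.o₁′ ∘ proj₁ π) ≈ K̄₃.d ∘ (h₁ ∘ g)
        commutes = begin
          a ∘ (M.o₁′ ∘ proj₁ π)   ≈⟨ extend (IsPullback.commute K̄-isPullback) ⟩
          s ∘ (q ∘ proj₁ π)       ≈⟨ ∘-resp-≈ʳ (proj₂ (proj₂ π)) ⟩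
          s ∘ (h₂ ∘ g)            ≈⟨ extend p ⟨
          K̄₃.d ∘ (h₁ ∘ g)         ∎
        κ : proj₁ π ⊑ M.o₁″
        κ = pullback-⊑₂ M.K₂₁-isPullback (proj₂ (pullback-⊑₁ ε-isPullback commutes))

    W-lift : ∀ {F} {h₁ : F ⇒ K̄₃.D} {h₂ : F ⇒ Q} → K̄₃.d ∘ h₁ ≈ s ∘ h₂ → h₁ ⊑ w₁
    W-lift {F} {h₁} {h₂} p = proj₁ f , d₃-mono _ _ (begin
        K̄₃.d ∘ (w₁ ∘ proj₁ f)   ≈⟨ extend (proj₂ s∘w₂⊑d₃) ⟩
        s ∘ (w₂ ∘ proj₁ f)      ≈⟨ ∘-resp-≈ʳ (t-mono _ _ (trans (cancel C (proj₂ ω⊑t)) (proj₂ f))) ⟩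
        s ∘ h₂                  ≈⟨ p ⟨
        K̄₃.d ∘ h₁               ∎)
      where
        f : t ∘ h₂ ⊑ ω
        f = fpc-⊑ ω-isFPC (t ∘ h₂) (ω-element p)

    w₁-mono : Mono C w₁
    w₁-mono = mono-first (mono-resp (sym (proj₂ s∘w₂⊑d₃)) (mono-∘ C s-mono w₂-mono))

    W-isPullback : IsPullback C w₁ w₂ K̄₃.d s
    W-isPullback = pullback-intro w₁-mono s-mono (proj₂ s∘w₂⊑d₃) λ h₁ h₂ → W-lift

    w₂∘k₂ : w₂ ∘ N.k₂ ≈ q ∘ M.o₁″
    w₂∘k₂ = t-mono _ _ (begin
      t ∘ (w₂ ∘ N.k₂)       ≈⟨ cancel C (proj₂ ω⊑t) ⟩
      ω ∘ N.k₂              ≈⟨ IsPullback.commute (IsFPC.isPullback ω-isFPC) ⟨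
      c ∘ (M.i₁′ ∘ M.o₁″)   ≈⟨ extend c∘v ⟩
      t ∘ (q ∘ M.o₁″)       ∎)

    -- The decomposition of `S` into `N₃₂` and `Q`, pulled back along `K̄₃.d`. It lets `glued` merge
    -- the two output pushouts into one over `K₃`.
    K̄₃-isPushout : IsPushout C M.i₂″ N.k₂ ε w₁
    K̄₃-isPushout = pushout-stable (mono-pushout p₂.out-mono M.K̄₁-isPushout) q-isPushout
      (d₃-mono _ _ (begin
        K̄₃.d ∘ (ε ∘ M.i₂″)      ≈⟨ extend (proj₂ e-lift) ⟩
        a ∘ (M.i₂′ ∘ M.i₂″)     ≈⟨ ∘-resp-≈ʳ (IsPullback.commute M.K₂₁-isPullback) ⟩
        a ∘ (M.o₁′ ∘ M.o₁″)     ≈⟨ extend (IsPullback.commute K̄-isPullback) ⟩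
        s ∘ (q ∘ M.o₁″)         ≈⟨ ∘-resp-≈ʳ w₂∘k₂ ⟨
        s ∘ (w₂ ∘ N.k₂)         ≈⟨ extend (proj₂ s∘w₂⊑d₃) ⟨
        K̄₃.d ∘ (w₁ ∘ N.k₂)      ∎))
      w₂∘k₂ M.K₂₁-isPullback (pullback-swap C ε-isPullback) W-isPullback

    b₃≈ : ε ∘ M.k₂ ≈ K̄₃.b
    b₃≈ = d₃-mono _ _ (begin
      K̄₃.d ∘ (ε ∘ M.k₂)      ≈⟨ extend (proj₂ e-lift) ⟩
      a ∘ (M.i₂′ ∘ M.k₂)     ≈⟨ ∘-resp-≈ʳ (IsPullback.commute (IsFPC.isPullback M.K̄₂-isFPC)) ⟨
      a ∘ (M.n₂ ∘ p₃.inₗ)    ≈⟨ cancel C a∘nE ⟩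
      j′ ∘ p₃.inₗ            ≈⟨ IsPullback.commute (IsFPC.isPullback K̄₃.isFPC) ⟩
      K̄₃.d ∘ K̄₃.b            ∎)

    abstract
      glued : Σ[ θ ∈ K̄₃.D ⇒ N.O₂₁ ] (IsPushout C p₃.outₗ (ε ∘ M.k₂) (N.o₂₁ ∘ M.o₂₁) θ × θ ∘ w₁ ≈ N.o₂′)
      glued = pushout-glue M.O₂₁-isPushout K̄₃-isPushout N.O₂₁-isPushout

    presents : Presents D (composite₍₃₂₎₁ p₃ p₂ p₁ ν)
    presents = record
      { d₃ = K̄₃.d ; b₃ = K̄₃.b ; r = N.k₁ ; ρ = L.ρ ; w₁ = w₁ ; w₂ = w₂
      ; o₃ = N.o₂₁ ∘ M.o₂₁ ; o′ = proj₁ glued ; i₁ = N.i₂₁ ; i′ = N.i₁′ ; h = N.i₂″ ; x = N.o₁″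
      ; d₃-mono = d₃-mono
      ; K̄₃-isFPC = K̄₃.isFPC
      ; R-isPushout = L.T-isPushout′
      ; W-isPullback = W-isPullback
      ; O-isPushout = pushout-resp refl b₃≈ refl refl (proj₁ (proj₂ glued))
      ; I-isPushout = N.I₂₁-isPushout
      ; K-isPullback = pullback-resp refl refl (sym (proj₂ ω⊑t)) refl
          (pullback-postmono (iso-mono φ) N.K₂₁-isPullback)
      ; out-factor = trans (∘-resp-≈ˡ (sym (proj₂ (proj₂ glued)))) assoc
      ; in-factor = refl }

  composites-agree : ∀ μ → Setoid._≈_ (Lin C) (composite₃₍₂₁₎ p₃ p₂ p₁ μ)
                             (composite₍₃₂₎₁ p₃ p₂ p₁ (Bijection.to correspondence μ))
  composites-agree μ =
    presents-unique {D} {composite₃₍₂₁₎ p₃ p₂ p₁ μ} {composite₍₃₂₎₁ p₃ p₂ p₁ (Bijection.to correspondence μ)}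
      (left-presents D μ (leftFrame-fits μ))
      (RightPresents.presents D (Bijection.to correspondence μ) fits)
    where
      D : Middle
      D = proj₁ (leftMiddle μ)
      fits : RightFits (Middle.frame D) (Bijection.to correspondence μ)
      fits = toRight-fits μ

  associativity : Σ[ φ ∈ Bijection (MatchPairs₃₍₂₁₎ p₃ p₂ p₁) (MatchPairs₍₃₂₎₁ p₃ p₂ p₁) ]
    (∀ μ → Setoid._≈_ (Lin C) (composite₃₍₂₁₎ p₃ p₂ p₁ μ)
                              (composite₍₃₂₎₁ p₃ p₂ p₁ (Bijection.to φ μ)))
  associativity = correspondence , composites-agree

mainTheorem2 : ∀ {o ℓ e : Level} (C : Category o ℓ e)
    (adhesive : Adhesive C) (hasFPCs : HasFPCsAlongMonos C) (stable : MonosStableUnderFPCs C) →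
    let open SqPO C adhesive hasFPCs stable in
    (p₁ p₂ p₃ : Setoid.Carrier (Lin C)) →
    Σ[ φ ∈ Bijection (MatchPairs₃₍₂₁₎ p₃ p₂ p₁) (MatchPairs₍₃₂₎₁ p₃ p₂ p₁) ]
    (∀ μ → Setoid._≈_ (Lin C) (composite₃₍₂₁₎ p₃ p₂ p₁ μ)
    (composite₍₃₂₎₁ p₃ p₂ p₁ (Bijection.to φ μ)))
mainTheorem2 = Associativity.associativity
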